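{- Let $U$ be a sunshine graph and $T$ a caterpillar of order $n$ with $b(U,T)\ge 5$, and let $U^+$ be a sunshine supercard of $U$ and $T$ (with $w,v$, labelling and $\chi$ as in the context) chosen so that $\chi(U^+)$ is largest possible among all sunshine supercards of $U$ and $T$. Suppose that $\mathrm{Aut}(U^+)$ contains a non-trivial rotation, and let $\delta,\phi,\Phi$ be as in the context. Consider the (not necessarily disjoint) cases: (i) $\{\lambda(x_\nu):\lambda\in\mathrm{Aut}(U^+)\text{ a reflection}\}\subseteq\Phi(x_\nu)$; (ii) $d_{U^+}(x_0)=3$ and $\{\lambda(x_0):\lambda\in\mathrm{Aut}(U^+)\text{ a reflection}\}\subseteq\Phi(x_0)$. Then (a) if case (i) or case (ii) holds, there exists a $U^+$-optimum saturating set $X$ such that $X\cap\mathrm{Aut}(U^+)=\Phi$, which is isomorphic to the cyclic group of order $\frac{c}{\delta}$; (b) if neither case holds, there exist a reflection $\pi\in\mathrm{Aut}(U^+)$ and a $U^+$-optimum saturating set $X$ such that $X\cap\mathrm{Aut}(U^+)=\Phi\cup\Phi\pi$, which is isomorphic to the dihedral group of order $\frac{2c}{\delta}$.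
   Context: All graphs are finite and simple. The deck of $G$ is the multiset of unlabelled cards $G-v$; $b(G,H)$ is the cardinality of the multiset intersection of the decks. The skeleton of a graph is obtained by deleting all vertices of degree $0$ or $1$; sunshine graph: connected, skeleton a cycle; caterpillar: connected, skeleton a path. A supercard of $U$ and $T$ is a graph of order $n+1$ whose deck contains cards isomorphic to $U$ and to $T$. For a sunshine supercard $U^+$, fix $w,v$ with $U^+-w\cong U$, $U^+-v\cong T$ ($w$ a leaf, $v$ a degree-2 cycle vertex); identify $U=U^+-w$, $T=U^+-v$. Label the cycle $x_0\ldots x_{c-1}x_0$ (indices are integers taken mod $c$) with $x_0$ adjacent to $w$, $v=x_\nu$, $d_{U^+}(x_{\nu-1})\ge d_{U^+}(x_{\nu+1})$; the leaves adjacent to $x_i$ are labelled $x_i^j$, $1\le j\le d_{U^+}(x_i)-2$, with $w=x_0^1$. Write $\lambda(G)=H$ if the bijection $\lambda$ is an isomorphism from $G$ onto $H$. $B_{vw}(U^+)=\{\lambda\in\mathrm{Sym}(V(U^+)):\lambda(U-\lambda^{ -1}(v))=T-\lambda(w)\}$, $B_U=\{\lambda\in B_{vw}(U^+):\lambda(U)=U^+-\lambda(w)\}$. A maximum saturating set is $X\subseteq B_{vw}(U^+)$ with: the identity in $X$; distinct $\lambda,\pi\in X$ have $\lambda^{ -1}(v)\ne\pi^{ -1}(v)$ and $\lambda(w)\ne\pi(w)$; and no $\sigma\in B_{vw}(U^+)\setminus X$ can be added keeping the previous property. $\chi(U^+)=\max|X\cap B_U|$ over maximum saturating sets; $X$ is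 $U^+$-optimum if $|X\cap B_U|=\chi(U^+)$. Every automorphism of $U^+$ maps the cycle to itself; it is a rotation if $\lambda(x_i)=x_{\alpha+i}$ for all $i$, a reflection if $\lambda(x_i)=x_{\alpha-i}$ for all $i$; a rotation is non-trivial if $\lambda(x_0)\ne x_0$. Let $\delta$ be the smallest positive integer $\beta$ such that $x_\beta=\lambda(x_0)$ for some rotation $\lambda\in\mathrm{Aut}(U^+)$; let $\phi\in\mathrm{Aut}(U^+)$ be the rotation with $\phi(x_i)=x_{\delta+i}$ and $\phi(x_i^j)=x_{\delta+i}^j$ for all $i,j$ (it exists and has order $c/\delta$); $\Phi=\{\phi^k:0\le k<c/\delta\}$; for a vertex $u$, $\Phi(u)=\{\lambda(u):\lambda\in\Phi\}$; $\Phi\pi=\{\lambda\pi:\lambda\in\Phi\}$. -}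

module Defs where

open import Data.Nat as ℕ using (ℕ; zero; suc; _≤_; _<_; _∸_; NonZero; _%_)
open import Data.Nat.DivMod using (m%n<n)
open import Data.Integer as ℤ using (ℤ; +_)
open import Data.Integer.DivMod using (_modℕ_; n%ℕd<d)
open import Data.Fin as Fin using (Fin; toℕ; fromℕ<; punchIn)
open import Data.Bool using (Bool; true; false; if_then_else_; _∧_; _∨_; not; _xor_)
open import Data.List using (List; []; _∷_; length; lookup; allFin; map)
open import Data.Nat.ListAction using (sum)
open import Data.Bool.ListAction using (and)
open import Data.List.Membership.Propositional using (_∈_)
open import Data.List.Relation.Unary.All using (All)
open import Data.Product using (Σ; Σ-syntax; _×_; _,_; ∃)
open import Data.Sum using (_⊎_)
open import Relation.Nullary using (¬_; does)
open import Relation.Binary.PropositionalEquality using (_≡_; _≢_)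
open import Function.Bundles using (_⇔_)

record Graph (n : ℕ) : Set where
  field
    adj    : Fin n → Fin n → Bool
    sym    : ∀ i j → adj i j ≡ adj j i
    irrefl : ∀ i → adj i i ≡ false
open Graph public

del : ∀ {n} → Graph (suc n) → Fin (suc n) → Graph n
del G v = record
  { adj    = λ i j → adj G (punchIn v i) (punchIn v j)
  ; sym    = λ i j → sym G (punchIn v i) (punchIn v j)
  ; irrefl = λ i → irrefl G (punchIn v i) }

record Perm (n : ℕ) : Set where
  field
    to   : Fin n → Fin n
    from : Fin n → Fin n
    from-to : ∀ i → from (to i) ≡ i
    to-from : ∀ i → to (from i) ≡ i
open Perm public

idPerm : ∀ {n} → Perm n
idPerm = record { to = λ i → i ; from = λ i → i
                ; from-to = λ _ → _≡_.refl ; to-from = λ _ → _≡_.refl }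

infixr 9 _∘ₚ_
_∘ₚ_ : ∀ {n} → Perm n → Perm n → Perm n
_∘ₚ_ {n} l p = record
  { to = λ i → to l (to p i) ; from = λ i → from p (from l i)
  ; from-to = ft ; to-from = tf }
  where
  open Relation.Binary.PropositionalEquality
  ft : ∀ i → from p (from l (to l (to p i))) ≡ i
  ft i = trans (cong (from p) (from-to l (to p i))) (from-to p i)
  tf : ∀ i → to l (to p (from p (from l i))) ≡ i
  tf i = trans (cong (to l) (to-from p (from l i))) (to-from l i)

pow : ∀ {n} → Perm n → ℕ → Perm n
pow f zero    = idPerm
pow f (suc k) = f ∘ₚ pow f k

_≈ₚ_ : ∀ {n} → Perm n → Perm n → Set
l ≈ₚ p = ∀ i → to l i ≡ to p i

Iso : ∀ {m} → Graph m → Graph m → Set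
Iso {m} G H = Σ (Perm m) λ f → ∀ i j → adj H (to f i) (to f j) ≡ adj G i j

IsAut : ∀ {m} → Graph m → Perm m → Set
IsAut G f = ∀ i j → adj G (to f i) (to f j) ≡ adj G i j

Injective : ∀ {A B : Set} → (A → B) → Set
Injective f = ∀ x y → f x ≡ f y → x ≡ y

deg : ∀ {n} → Graph n → Fin n → ℕ
deg {n} G v = sum (map (λ u → if adj G v u then 1 else 0) (allFin n))

data Reach {n} (G : Graph n) : Fin n → Fin n → Set where
  here : ∀ {u} → Reach G u u
  step : ∀ {u x y} → Reach G u x → adj G x y ≡ true → Reach G u y

Connected : ∀ {n} → Graph n → Set
Connected G = ∀ u v → Reach G u v

-- natural-number remainder (total; only used with positive modulus)
_mod_ : ℕ → ℕ → ℕ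
a mod zero    = a
a mod (suc c) = a % suc c

SkeletonIsCycle : ∀ {n} → Graph n → Set
SkeletonIsCycle {n} G =
  Σ ℕ λ c → 3 ≤ c × Σ (Fin c → Fin n) λ x →
    Injective x
  × (∀ i → 2 ≤ deg G (x i))
  × (∀ u → 2 ≤ deg G u → Σ (Fin c) λ i → x i ≡ u)
  × (∀ i k → (adj G (x i) (x k) ≡ true) ⇔
       (toℕ k ≡ (suc (toℕ i)) mod c ⊎ toℕ i ≡ (suc (toℕ k)) mod c))

SkeletonIsPath : ∀ {n} → Graph n → Set
SkeletonIsPath {n} G =
  Σ ℕ λ k → 1 ≤ k × Σ (Fin k → Fin n) λ x →
    Injective x
  × (∀ i → 2 ≤ deg G (x i))
  × (∀ u → 2 ≤ deg G u → Σ (Fin k) λ i → x i ≡ u)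
  × (∀ i j → (adj G (x i) (x j) ≡ true) ⇔
       (toℕ j ≡ suc (toℕ i) ⊎ toℕ i ≡ suc (toℕ j)))

Sunshine : ∀ {n} → Graph n → Set
Sunshine G = Connected G × SkeletonIsCycle G

Caterpillar : ∀ {n} → Graph n → Set
Caterpillar G = Connected G × SkeletonIsPath G

-- b(G,H) ≥ k : the multiset intersection of the decks has at least k
-- elements, i.e. k distinct cards of G can be matched with k distinct
-- cards of H, matched cards being isomorphic
BAtLeast : ∀ {n} → ℕ → Graph (suc n) → Graph (suc n) → Set
BAtLeast {n} k G H =
  Σ (Fin k → Fin (suc n)) λ f → Σ (Fin k → Fin (suc n)) λ g →
    Injective f × Injective g × (∀ i → Iso (del G (f i)) (del H (g i)))

record SunSuper {n} (U T : Graph (suc n)) : Set where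
  field
    Up   : Graph (suc (suc n))
    w    : Fin (suc (suc n))
    v    : Fin (suc (suc n))
    isoU : Iso (del Up w) U
    isoT : Iso (del Up v) T
    sun  : Sunshine Up
    w-leaf : deg Up w ≡ 1
    v-deg2 : deg Up v ≡ 2
open SunSuper public

module _ {N : ℕ} (Up : Graph N) (w v : Fin N) where

  -- λ ∈ B_vw(U⁺) : λ(U - λ⁻¹(v)) = T - λ(w), where U = U⁺ - w, T = U⁺ - v
  -- (λ⁻¹(v) must be a vertex of U, i.e. λ(w) ≠ v)
  InB : Perm N → Set
  InB l = to l w ≢ v ×
    (∀ i j → i ≢ w → i ≢ from l v → j ≢ w → j ≢ from l v →
       adj Up (to l i) (to l j) ≡ adj Up i j)

  -- λ(U) = U⁺ - λ(w)  (boolean test, used for counting |X ∩ B_U|)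
  isBU : Perm N → Bool
  isBU l = and (map (λ i → and (map (λ j →
      does (i Fin.≟ w) ∨ does (j Fin.≟ w) ∨
      not (adj Up (to l i) (to l j) xor adj Up i j)) (allFin N))) (allFin N))

  -- |X ∩ B_U|   (X ⊆ B_vw is required separately)
  countBU : List (Perm N) → ℕ
  countBU []       = 0
  countBU (l ∷ ls) = (if isBU l then 1 else 0) ℕ.+ countBU ls

  -- X is a maximum saturating set (X a finite set of permutations,
  -- listed without repetition; distinct positions = distinct elements)
  MaxSat : List (Perm N) → Set
  MaxSat X =
      (Σ (Perm N) λ μ → μ ∈ X × μ ≈ₚ idPerm)
    × All InB X
    × (∀ (p q : Fin (length X)) → p ≢ q →
         (from (lookup X p) v ≢ from (lookup X q) v)
       × (to (lookup X p) w ≢ to (lookup X q) w))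
    × (∀ σ → InB σ → (∀ μ → μ ∈ X → ¬ (σ ≈ₚ μ)) →
         Σ (Perm N) λ μ → μ ∈ X ×
           (from σ v ≡ from μ v ⊎ to σ w ≡ to μ w))

  -- X is U⁺-optimum : |X ∩ B_U| = χ(U⁺)
  Optimum : List (Perm N) → Set
  Optimum X = MaxSat X × (∀ Y → MaxSat Y → countBU Y ℕ.≤ countBU X)

ChiLE : ∀ {n} {U T : Graph (suc n)} → SunSuper U T → SunSuper U T → Set
ChiLE S' S =
  ∀ Y → MaxSat (Up S') (w S') (v S') Y →
    Σ (List (Perm _)) λ X → MaxSat (Up S) (w S) (v S) X ×
      countBU (Up S') (w S') (v S') Y ℕ.≤ countBU (Up S) (w S) (v S) X

ChiMaximal : ∀ {n} {U T : Graph (suc n)} → SunSuper U T → Set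
ChiMaximal {U = U} {T} S = ∀ (S' : SunSuper U T) → ChiLE S' S

idx : (c : ℕ) .{{_ : NonZero c}} → ℤ → Fin c
idx c i = fromℕ< (n%ℕd<d i c)

record Labelling {N : ℕ} (Up : Graph N) (w v : Fin N) : Set where
  field
    c      : ℕ
    {{c-nz}} : NonZero c
    c≥3    : 3 ≤ c
    x      : Fin c → Fin N
    x-inj  : Injective x
    x-skel : ∀ i → 2 ≤ deg Up (x i)
    x-all  : ∀ u → 2 ≤ deg Up u → Σ (Fin c) λ i → x i ≡ u
    x-adj  : ∀ (i k : ℤ) → (adj Up (x (idx c i)) (x (idx c k)) ≡ true) ⇔
               (idx c k ≡ idx c (i ℤ.+ + 1) ⊎ idx c i ≡ idx c (k ℤ.+ + 1))
    -- the leaves x_i^j (j = 1 … d(x_i)-2 is represented by Fin (d(x_i)-2))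
    leaf     : (i : Fin c) → Fin (deg Up (x i) ∸ 2) → Fin N
    leaf-adj : ∀ i j → adj Up (x i) (leaf i j) ≡ true
    leaf-deg : ∀ i j → deg Up (leaf i j) ≡ 1
    leaf-inj : ∀ i i' j j' → leaf i j ≡ leaf i' j' → (i ≡ i') × (toℕ j ≡ toℕ j')
    cover    : ∀ u → (Σ (Fin c) λ i → x i ≡ u)
                   ⊎ (Σ (Fin c) λ i → Σ (Fin (deg Up (x i) ∸ 2)) λ j → leaf i j ≡ u)
    -- w = x_0^1
    w-lab    : Σ (Fin (deg Up (x (idx c (+ 0))) ∸ 2)) λ j →
                 (toℕ j ≡ 0) × (leaf (idx c (+ 0)) j ≡ w)
    ν        : ℤ
    v-lab    : x (idx c ν) ≡ v
    ν-deg    : deg Up (x (idx c (ν ℤ.+ + 1))) ≤ deg Up (x (idx c (ν ℤ.- + 1)))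
open Labelling public

module _ {N : ℕ} {Up : Graph N} {w v : Fin N} (L : Labelling Up w v) where

  X : ℤ → Fin N
  X i = x L (idx (c L) i)

  IsRotation : Perm N → Set
  IsRotation l = Σ ℤ λ α → ∀ i → to l (X i) ≡ X (α ℤ.+ i)

  IsReflection : Perm N → Set
  IsReflection l = Σ ℤ λ α → ∀ i → to l (X i) ≡ X (α ℤ.- i)

  NontrivialRotation : Set
  NontrivialRotation =
    Σ (Perm N) λ l → IsAut Up l × IsRotation l × to l (X (+ 0)) ≢ X (+ 0)

  IsDelta : ℕ → Set
  IsDelta δ =
      1 ≤ δ
    × (Σ (Perm N) λ l → IsAut Up l × IsRotation l × to l (X (+ 0)) ≡ X (+ δ))
    × (∀ β → 1 ≤ β →
         (Σ (Perm N) λ l → IsAut Up l × IsRotation l × to l (X (+ 0)) ≡ X (+ β)) →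
         δ ≤ β)

  IsPhi : ℕ → Perm N → Set
  IsPhi δ φ =
      (∀ i → to φ (X i) ≡ X (+ δ ℤ.+ i))
    × (∀ (i : Fin (c L)) j j' → toℕ j ≡ toℕ j' →
         to φ (leaf L i j) ≡ leaf L (idx (c L) (+ δ ℤ.+ + toℕ i)) j')

InΦ : ∀ {N} → Perm N → ℕ → Perm N → Set
InΦ φ m l = Σ ℕ λ k → k < m × l ≈ₚ pow φ k

InΦπ : ∀ {N} → Perm N → ℕ → Perm N → Perm N → Set
InΦπ φ m π l = Σ ℕ λ k → k < m × l ≈ₚ (pow φ k ∘ₚ π)

InterAutEq : ∀ {N} → Graph N → List (Perm N) → (Perm N → Set) → Set
InterAutEq {N} Up Xs S =
    (∀ l → l ∈ Xs → IsAut Up l → S l)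
  × (∀ l → S l → IsAut Up l × (Σ (Perm N) λ μ → μ ∈ Xs × μ ≈ₚ l))

_+ₘ_ : ∀ {m} → Fin m → Fin m → Fin m
_+ₘ_ {suc m} a b = fromℕ< (m%n<n (toℕ a ℕ.+ toℕ b) (suc m))

-ₘ_ : ∀ {m} → Fin m → Fin m
-ₘ_ {suc m} a = fromℕ< (m%n<n (suc m ∸ toℕ a) (suc m))

IsCyclicGroup : ∀ {N} → (Perm N → Set) → ℕ → Set
IsCyclicGroup {N} S m =
  Σ (Fin m → Perm N) λ f →
      (∀ a → S (f a))
    × (∀ l → S l → Σ (Fin m) λ a → l ≈ₚ f a)
    × (∀ a b → f a ≈ₚ f b → a ≡ b)
    × (∀ a b → f (a +ₘ b) ≈ₚ (f a ∘ₚ f b))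

-- dihedral group of order 2m: elements r^a s^e, (a , e) ∈ Fin m × Bool,
-- with s r = r⁻¹ s
dihMul : ∀ {m} → Fin m × Bool → Fin m × Bool → Fin m × Bool
dihMul (a , e) (b , e') = (a +ₘ (if e then -ₘ b else b)) , (e xor e')

IsDihedralGroup : ∀ {N} → (Perm N → Set) → ℕ → Set
IsDihedralGroup {N} S m =
  Σ (Fin m × Bool → Perm N) λ f →
      (∀ a → S (f a))
    × (∀ l → S l → Σ (Fin m × Bool) λ a → l ≈ₚ f a)
    × (∀ a b → f a ≈ₚ f b → a ≡ b)
    × (∀ a b → f (dihMul a b) ≈ₚ (f a ∘ₚ f b))

{-# OPTIONS --safe #-}
module Submission where

-- A non-trivial rotation forces B_U = Aut(U⁺): a member λ of B_U acts on the cycle as a rotation or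
-- reflection ρ, and if λ(w) were not attached to λ(x₀), the periodic sequences d(x_i) and d(x_ρ(i))
-- would differ by +1 at i = 0 and by -1 at a single other place, and nowhere else. Hence |X ∩ B_U|
-- counts the automorphisms in X. Distinct members λ of X have distinct λ⁻¹(v) and distinct λ(w), so
-- |X ∩ Aut(U⁺)| is at most c/δ in cases (i) and (ii), and at most 2c/δ always. Φ, respectively Φ ∪ Φπ,
-- attains the bound, and every automorphism agrees with one of its members in λ⁻¹(v), or every one
-- does in λ(w); so completing it greedily to a saturating set adds no automorphism.

open import Defs hiding (sym)
open import Data.Bool using (Bool; true; false; if_then_else_; not; _∨_; _xor_)
import Data.Bool as Bool
import Data.Bool.Properties as Bool
open import Data.Bool.ListAction using (and)
open import Data.Empty using (⊥)
open import Data.Fin as Fin using (Fin; zero; suc; toℕ; fromℕ<; punchIn; punchOut)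
import Data.Fin.Permutation as Permutation
import Data.Fin.Properties as Fin
open import Data.Integer as ℤ using (ℤ; +_; -_; _+_; _-_; _*_; 0ℤ; 1ℤ; -1ℤ; ∣_∣)
import Data.Integer.Properties as ℤ
open import Data.Integer.Divisibility.Signed
  using (_∣_; divides; ∣⇒∣ᵤ; _∣?_; ∣-refl; ∣-trans; ∣m∣n⇒∣m+n; ∣m∣n⇒∣m-n; ∣m⇒∣-m; ∣n⇒∣m*n; *-cancelʳ-∣)
open import Data.Integer.DivMod using (_%ℕ_; _/ℕ_; n%ℕd<d; a≡a%ℕn+[a/ℕn]*n)
open import Data.Integer.Tactic.RingSolver using (solve-∀)
open import Data.List using (List; []; _∷_; map; allFin; tabulate; filter; length; lookup)
open import Data.List.Membership.Propositional using (_∈_; lose; find)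
open import Data.List.Membership.Propositional.Properties using (∈-tabulate⁺; ∈-tabulate⁻; ∈-allFin; ∈-lookup)
open import Data.List.Properties using (map-tabulate; tabulate-lookup)
open import Data.List.Relation.Unary.All as All using (All; []; _∷_)
import Data.List.Relation.Unary.All.Properties as All
open import Data.List.Relation.Unary.AllPairs as AllPairs using (AllPairs; []; _∷_)
import Data.List.Relation.Unary.AllPairs.Properties as AllPairs
open import Data.List.Relation.Unary.Any using (Any; here; there)
open import Data.Nat as ℕ using (ℕ; zero; suc; NonZero; _/_; _<_; _≤_; _∸_; z≤n; s≤s)
import Data.Nat.Divisibility as ℕ using (∣⇒≤)
import Data.Nat.DivMod as ℕ using (m<n⇒m%n≡m; m%n<n; m/n*n≡m)
import Data.Nat.ListAction as ListAction
import Data.Nat.Properties as ℕ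
open import Data.Product using (Σ; ∃; _×_; _,_; proj₁; proj₂; map₂)
import Data.Product.Properties as Product
open import Data.Sum using (_⊎_; inj₁; inj₂; swap; [_,_]′)
open import Data.Vec as Vec using (Vec; []; _∷_)
import Data.Vec.Properties as Vec
open import Function using (_∘_; id)
open import Function.Bundles using (Equivalence)
open import Relation.Binary.PropositionalEquality
  using (_≡_; _≢_; refl; sym; trans; cong; cong₂; subst; module ≡-Reasoning)
open import Relation.Nullary using (¬_; Dec; yes; no; does; contradiction)
open import Relation.Nullary.Decidable using (map′; _×-dec_; _→-dec_; ¬?; dec-false; decidable-stable)
open import Algebra.Properties.CommutativeMonoid.Sum ℕ.+-0-commutativeMonoid
  using (sum-remove; sum-permute; sum-cong-≗) renaming (sum to ∑)

-- Members of X differ in both λ⁻¹(v) and λ(w), so either coordinate can serve for an upper bound.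
-- For automorphisms in case (i) every λ⁻¹(v) lies in Φ(v); in case (ii) w is the only leaf at x_0,
-- so λ(w) is determined by λ(x_0) and lies in Φ(w). In general the rotation shifts are the
-- multiples of δ and two reflections differ by a rotation, so the values λ⁻¹(v) lie in at most two
-- orbits of Φ. Φ ∪ Φπ must be separated in both coordinates, and this shapes π. The reflection x_i
-- ↦ x_(α-i) moves x_ν out of Φ(x_ν) exactly when δ does not divide α-2ν. For w the leaves leave
-- some freedom: reversing their order at every cycle vertex takes w off Φ(w) if x_0 has several
-- leaves; if it has only one, failure of case (ii) shows that δ does not divide α. Reversal also
-- makes π an involution, as the dihedral relations require. Failure of case (i) is a mere negation,
-- so α comes from a search over the finitely many symmetries of the degree sequence, each of which
-- some reflection realises.

bool-ext : ∀ {a b : Bool} → (a ≡ true → b ≡ true) → (b ≡ true → a ≡ true) → a ≡ b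
bool-ext {false} {false} f g = refl
bool-ext {false} {true}  f g = g refl
bool-ext {true}  {false} f g = sym (f refl)
bool-ext {true}  {true}  f g = refl

-- Degrees as sums of adjacency indicators

indicator : Bool → ℕ
indicator b = if b then 1 else 0

sum-tabulate : ∀ {n} (f : Fin n → ℕ) → ListAction.sum (tabulate f) ≡ ∑ f
sum-tabulate {zero}  f = refl
sum-tabulate {suc n} f = cong (f zero ℕ.+_) (sum-tabulate (f ∘ suc))

deg-∑ : ∀ {n} (G : Graph n) u → deg G u ≡ ∑ (λ a → indicator (adj G u a))
deg-∑ G u = trans (cong ListAction.sum (map-tabulate id (λ a → indicator (adj G u a))))
                  (sum-tabulate (λ a → indicator (adj G u a)))

-- Arranged without subtraction, since the value at `w` may go up or down: both sides are the common
-- part off `w` plus both values at `w`.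
∑-agree-off : ∀ {n} (f g : Fin n → ℕ) w → (∀ u → u ≢ w → f u ≡ g u) →
              ∑ f ℕ.+ g w ≡ ∑ g ℕ.+ f w
∑-agree-off {suc n} f g w agree = begin
  ∑ f ℕ.+ g w                        ≡⟨ cong (ℕ._+ g w) (sum-remove {i = w} f) ⟩
  f w ℕ.+ ∑ (f ∘ punchIn w) ℕ.+ g w  ≡⟨ cong (λ s → f w ℕ.+ s ℕ.+ g w)
                                         (sum-cong-≗ (λ i → agree (punchIn w i) (Fin.punchInᵢ≢i w i))) ⟩
  f w ℕ.+ ∑ (g ∘ punchIn w) ℕ.+ g w  ≡⟨ ℕ.+-comm (f w ℕ.+ ∑ (g ∘ punchIn w)) (g w) ⟩
  g w ℕ.+ (f w ℕ.+ ∑ (g ∘ punchIn w)) ≡⟨ cong (g w ℕ.+_) (ℕ.+-comm (f w) _) ⟩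
  g w ℕ.+ (∑ (g ∘ punchIn w) ℕ.+ f w) ≡⟨ ℕ.+-assoc (g w) _ (f w) ⟨
  g w ℕ.+ ∑ (g ∘ punchIn w) ℕ.+ f w  ≡⟨ cong (ℕ._+ f w) (sum-remove {i = w} g) ⟨
  ∑ g ℕ.+ f w                        ∎
  where open ≡-Reasoning

term≤∑ : ∀ {n} (f : Fin n → ℕ) i → f i ≤ ∑ f
term≤∑ {suc n} f i = subst (f i ≤_) (sym (sum-remove {i = i} f)) (ℕ.m≤m+n _ _)

two-neighbours : ∀ {n} (G : Graph n) {u a b} → adj G u a ≡ true → adj G u b ≡ true → a ≢ b → 2 ≤ deg G u
two-neighbours {suc n} G {u} {a} {b} ua ub a≢b = begin
  2                                         ≡⟨ cong₂ (λ p q → indicator p ℕ.+ indicator q) (sym ua) (sym ub) ⟩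
  f a ℕ.+ f b                               ≡⟨ cong (λ z → f a ℕ.+ f z) (sym (Fin.punchIn-punchOut a≢b)) ⟩
  f a ℕ.+ f (punchIn a (punchOut a≢b))      ≤⟨ ℕ.+-monoʳ-≤ (f a) (term≤∑ (f ∘ punchIn a) (punchOut a≢b)) ⟩
  f a ℕ.+ ∑ (f ∘ punchIn a)                 ≡⟨ sum-remove {i = a} f ⟨
  ∑ f                                       ≡⟨ deg-∑ G u ⟨
  deg G u                                   ∎
  where
  open ℕ.≤-Reasoning
  f : Fin (suc n) → ℕ
  f z = indicator (adj G u z)

leaf-neighbour : ∀ {n} (G : Graph n) {u a b} → deg G u ≡ 1 → adj G u a ≡ true → adj G u b ≡ true → a ≡ b
leaf-neighbour G {u} {a} {b} d ua ub with a Fin.≟ b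
... | yes a≡b = a≡b
... | no  a≢b with s≤s () ← subst (2 ≤_) d (two-neighbours G ua ub a≢b)

-- Permutations, automorphisms and degrees

to-injective : ∀ {n} (l : Perm n) {i j} → to l i ≡ to l j → i ≡ j
to-injective l {i} {j} e = trans (sym (from-to l i)) (trans (cong (from l) e) (from-to l j))

from-of : ∀ {n} (l : Perm n) {i j} → to l i ≡ j → from l j ≡ i
from-of l {i} refl = from-to l i

from-cong : ∀ {n} {l m : Perm n} → l ≈ₚ m → ∀ i → from l i ≡ from m i
from-cong {l = l} {m} l≈m i = from-of l (trans (l≈m _) (to-from m i))

∑-perm : ∀ {n} (l : Perm n) (f : Fin n → ℕ) → ∑ f ≡ ∑ (f ∘ to l)
∑-perm l f = sum-permute f (Permutation.permutation (to l) (from l)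
               (to-from l) (from-to l))

-- Reindexing the row of `to l i` along `l` leaves two rows that can differ only in column `w`.
-- Nothing is assumed about edges at `w`, so the two indicators record the possible changes of
-- degree by one.
deg-of-card-iso : ∀ {n} (G : Graph n) (l : Perm n) {w} →
  (∀ i j → i ≢ w → j ≢ w → adj G (to l i) (to l j) ≡ adj G i j) →
  ∀ i → i ≢ w → deg G (to l i) ℕ.+ indicator (adj G i w) ≡ deg G i ℕ.+ indicator (adj G (to l i) (to l w))
deg-of-card-iso G l {w} pres i i≢w
  rewrite deg-∑ G (to l i) | deg-∑ G i | ∑-perm l (λ a → indicator (adj G (to l i) a))
  = ∑-agree-off _ _ w (λ u u≢w → cong indicator (pres i u i≢w u≢w))

deg-aut : ∀ {n} (G : Graph n) (l : Perm n) → IsAut G l → ∀ i → deg G (to l i) ≡ deg G i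
deg-aut G l aut i
  rewrite deg-∑ G (to l i) | deg-∑ G i | ∑-perm l (λ a → indicator (adj G (to l i) a))
  = sum-cong-≗ (λ u → cong indicator (aut i u))

invₚ : ∀ {n} → Perm n → Perm n
invₚ l = record { to = from l ; from = to l ; from-to = to-from l ; to-from = from-to l }

inv-aut : ∀ {n} (G : Graph n) (l : Perm n) → IsAut G l → IsAut G (invₚ l)
inv-aut G l aut i j = trans (sym (aut (from l i) (from l j))) (cong₂ (adj G) (to-from l i) (to-from l j))

∘-aut : ∀ {n} (G : Graph n) (l m : Perm n) → IsAut G l → IsAut G m → IsAut G (l ∘ₚ m)
∘-aut G l m al am i j = trans (al _ _) (am i j)

pow-aut : ∀ {n} (G : Graph n) (l : Perm n) → IsAut G l → ∀ k → IsAut G (pow l k)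
pow-aut G l al zero    i j = refl
pow-aut G l al (suc k) = ∘-aut G l (pow l k) al (pow-aut G l al k)

-- Exhaustive search over permutations

any-vec? : ∀ {k} n {P : Vec (Fin k) n → Set} → (∀ xs → Dec (P xs)) → Dec (∃ P)
any-vec? zero    P? = map′ ([] ,_) (λ { ([] , p) → p }) (P? [])
any-vec? (suc n) P? = map′ (λ { (i , xs , p) → i ∷ xs , p }) (λ { (i ∷ xs , p) → i , xs , p })
                           (Fin.any? (λ i → any-vec? n (λ xs → P? (i ∷ xs))))

-- Functions cannot be enumerated as such, so the search runs over pairs of mutually inverse value
-- vectors. The vectors of a given `l` recover it only pointwise, which is why `P` has to respect
-- `≈ₚ`.
any-perm? : ∀ {n} {P : Perm n → Set} → (∀ {l m} → l ≈ₚ m → P l → P m) → (∀ l → Dec (P l)) → Dec (∃ P)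
any-perm? {n} {P} resp P? =
  map′ (λ { (f , g , e , p) → perm f g e , p })
       (λ { (l , p) → let f = Vec.tabulate (to l) ; g = Vec.tabulate (from l) ; e = inverse l in
              f , g , e , resp (λ i → sym (Vec.lookup∘tabulate (to l) i)) p })
       (any-vec? n (λ f → any-vec? n (λ g → good? f g)))
  where
  Inverse : Vec (Fin n) n → Vec (Fin n) n → Set
  Inverse f g = (∀ i → Vec.lookup g (Vec.lookup f i) ≡ i) × (∀ i → Vec.lookup f (Vec.lookup g i) ≡ i)

  perm : ∀ f g → Inverse f g → Perm n
  perm f g (gf , fg) = record { to = Vec.lookup f ; from = Vec.lookup g ; from-to = gf ; to-from = fg }

  inverse : ∀ l → Inverse (Vec.tabulate (to l)) (Vec.tabulate (from l))
  inverse l =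
      (λ i → trans (Vec.lookup∘tabulate (from l) _) (trans (cong (from l) (Vec.lookup∘tabulate (to l) i)) (from-to l i)))
    , (λ i → trans (Vec.lookup∘tabulate (to l) _) (trans (cong (to l) (Vec.lookup∘tabulate (from l) i)) (to-from l i)))

  good? : ∀ f g → Dec (Σ (Inverse f g) λ e → P (perm f g e))
  good? f g with Fin.all? (λ i → Vec.lookup g (Vec.lookup f i) Fin.≟ i)
               ×-dec Fin.all? (λ i → Vec.lookup f (Vec.lookup g i) Fin.≟ i)
  ... | no  ¬e = no (¬e ∘ proj₁)
  ... | yes e  = map′ (e ,_) (λ { (e′ , p) → resp (λ _ → refl) p }) (P? (perm f g e))

module _ {A : Set} {R : A → A → Set} (R-sym : ∀ {a b} → R a b → R b a) where

  lookup-pair : ∀ {xs} → AllPairs R xs → ∀ p q → p ≢ q → R (lookup xs p) (lookup xs q)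
  lookup-pair (r ∷ rs) zero    zero    p≢q = contradiction refl p≢q
  lookup-pair (r ∷ rs) zero    (suc q) p≢q = All.lookup r (∈-lookup q)
  lookup-pair (r ∷ rs) (suc p) zero    p≢q = R-sym (All.lookup r (∈-lookup p))
  lookup-pair (r ∷ rs) (suc p) (suc q) p≢q = lookup-pair rs p q (p≢q ∘ cong suc)

pairs-lookup : ∀ {A : Set} {R : A → A → Set} xs → (∀ p q → p ≢ q → R (lookup xs p) (lookup xs q)) → AllPairs R xs
pairs-lookup {R = R} xs r = subst (AllPairs R) (tabulate-lookup xs) (AllPairs.tabulate⁺ (λ {p} {q} → r p q))

-- Saturating sets: greedy completion and counting

module Saturating {N : ℕ} (Up : Graph N) (w v : Fin N) where

  Separated Conflict : Perm N → Perm N → Set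
  Separated l m = (from l v ≢ from m v) × (to l w ≢ to m w)
  Conflict  l m = (from l v ≡ from m v) ⊎ (to l w ≡ to m w)

  separated-sym : ∀ {l m} → Separated l m → Separated m l
  separated-sym (p , q) = (p ∘ sym) , (q ∘ sym)

  separated? : ∀ l m → Dec (Separated l m)
  separated? l m = ¬? (from l v Fin.≟ from m v) ×-dec ¬? (to l w Fin.≟ to m w)

  ¬separated⇒conflict : ∀ l m → ¬ Separated l m → Conflict l m
  ¬separated⇒conflict l m ¬s with from l v Fin.≟ from m v | to l w Fin.≟ to m w
  ... | yes p | _     = inj₁ p
  ... | no _  | yes q = inj₂ q
  ... | no p  | no q  = contradiction (p , q) ¬s

  conflict⇒¬separated : ∀ {l m} → Conflict l m → ¬ Separated l m
  conflict⇒¬separated (inj₁ p) (s , _) = s p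
  conflict⇒¬separated (inj₂ q) (_ , s) = s q

  inB? : ∀ l → Dec (InB Up w v l)
  inB? l = ¬? (to l w Fin.≟ v) ×-dec
    Fin.all? (λ i → Fin.all? (λ j →
      ¬? (i Fin.≟ w) →-dec ¬? (i Fin.≟ from l v) →-dec ¬? (j Fin.≟ w) →-dec ¬? (j Fin.≟ from l v) →-dec
      (adj Up (to l i) (to l j) Bool.≟ adj Up i j)))

  inB-resp : ∀ {l m} → l ≈ₚ m → InB Up w v l → InB Up w v m
  inB-resp {l} {m} l≈m (lw , iso) = (λ e → lw (trans (l≈m w) e)) , λ i j iw iv jw jv →
    trans (sym (cong₂ (adj Up) (l≈m i) (l≈m j)))
          (iso i j iw (λ e → iv (trans e (from-cong {l = l} {m} l≈m v)))
                   jw (λ e → jv (trans e (from-cong {l = l} {m} l≈m v))))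

  separated-resp : ∀ {l m μ} → l ≈ₚ m → Separated l μ → Separated m μ
  separated-resp {l} {m} l≈m (p , q) =
    (λ e → p (trans (from-cong {l = l} {m} l≈m v) e)) , (λ e → q (trans (l≈m w) e))

  addable? : ∀ a Y → Dec (Σ (Perm N) λ σ → InB Up w v σ × from σ v ≡ a × All (Separated σ) Y)
  addable? a Y = any-perm?
    (λ {l} {m} e → λ { (b , f , s) → inB-resp {l} {m} e b , trans (sym (from-cong {l = l} {m} e v)) f
                                   , All.map (λ {μ} → separated-resp {l} {m} {μ} e) s })
    (λ σ → inB? σ ×-dec (from σ v Fin.≟ a) ×-dec All.all? (separated? σ) Y)

  -- `new` is what later keeps further automorphisms out: an added element is separated from all of
  -- `Y`, and no automorphism is when `Y` lists the chosen group. `maximal` speaks only of the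
  -- preimages of `v` treated so far, to suit recursion on `as`.
  record Completion (as : List (Fin N)) (Y : List (Perm N)) : Set where
    field
      carrier   : List (Perm N)
      inB       : All (InB Up w v) carrier
      separated : AllPairs Separated carrier
      extends   : ∀ {l} → l ∈ Y → l ∈ carrier
      new       : ∀ {l} → l ∈ carrier → l ∈ Y ⊎ All (Separated l) Y
      count     : countBU Up w v Y ≤ countBU Up w v carrier
      maximal   : ∀ σ → InB Up w v σ → from σ v ∈ as → Any (Conflict σ) carrier

  -- One attempt per vertex `a` is enough. If some `τ` with `from τ v ≡ a` is added, every `σ` with
  -- the same preimage of `v` conflicts with it; if none can be added, every such `σ` already
  -- conflicts with a member of `Y`.
  complete : ∀ as Y → All (InB Up w v) Y → AllPairs Separated Y → Completion as Y
  complete [] Y b s = record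
    { carrier = Y ; inB = b ; separated = s ; extends = id ; new = inj₁ ; count = ℕ.≤-refl
    ; maximal = λ σ _ () }
  complete (a ∷ as) Y b s with addable? a Y
  ... | yes (τ , τb , τv , τs) = record
    { carrier = carrier ; inB = inB ; separated = separated
    ; extends = extends ∘ there
    ; new     = λ l∈ → [ (λ { (here refl) → inj₂ τs ; (there l∈Y) → inj₁ l∈Y }) , inj₂ ∘ All.tail ]′ (new l∈)
    ; count   = ℕ.≤-trans (ℕ.m≤n+m _ _) count
    ; maximal = λ { σ σb (here e)  → lose (extends (here refl)) (inj₁ (trans e (sym τv)))
                  ; σ σb (there i) → maximal σ σb i } }
    where open Completion (complete as (τ ∷ Y) (τb ∷ b) (τs ∷ s))
  ... | no ¬add = record
    { carrier = carrier ; inB = inB ; separated = separated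
    ; extends = extends ; new = new ; count = count
    ; maximal = λ { σ σb (here e)  → conflicts σ σb e
                  ; σ σb (there i) → maximal σ σb i } }
    where
    open Completion (complete as Y b s)
    conflicts : ∀ σ → InB Up w v σ → from σ v ≡ a → Any (Conflict σ) carrier
    conflicts σ σb e =
      let any = All.¬All⇒Any¬ (separated? σ) Y (λ σs → ¬add (σ , σb , e , σs))
          (μ , μ∈ , ¬s) = find any
      in lose (extends μ∈) (¬separated⇒conflict σ μ ¬s)

  countBU-tabulate : ∀ {K} (f : Fin K → Perm N) → (∀ k → isBU Up w v (f k) ≡ true) → countBU Up w v (tabulate f) ≡ K
  countBU-tabulate {zero}  f bu = refl
  countBU-tabulate {suc K} f bu rewrite bu zero = cong suc (countBU-tabulate (f ∘ suc) (bu ∘ suc))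

  bu? : ∀ l → Dec (isBU Up w v l ≡ true)
  bu? l = isBU Up w v l Bool.≟ true

  countBU-filter : ∀ Y → countBU Up w v Y ≡ length (filter bu? Y)
  countBU-filter [] = refl
  countBU-filter (l ∷ Y) with isBU Up w v l
  ... | true  = cong suc (countBU-filter Y)
  ... | false = countBU-filter Y

  -- Pigeonhole on the members that are counted: their keys stay pairwise distinct after filtering
  -- and take at most `K` values. `key` is left open because it becomes the preimage of `v` or the
  -- image of `w`, depending on the case.
  countBU-bound : ∀ {K} (key : Perm N → Fin N) (g : Fin K → Fin N) →
    (∀ l → isBU Up w v l ≡ true → InB Up w v l → Σ (Fin K) λ k → key l ≡ g k) →
    ∀ Y → All (InB Up w v) Y → AllPairs (λ l m → key l ≢ key m) Y → countBU Up w v Y ≤ K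
  countBU-bound {K} key g hit Y b s = subst (_≤ K) (sym (countBU-filter Y))
    (Fin.injective⇒≤ {f = λ p → proj₁ (slot p)} injective)
    where
    Z = filter bu? Y
    slot : ∀ p → Σ (Fin K) λ k → key (lookup Z p) ≡ g k
    slot p = hit (lookup Z p) (All.lookup (All.all-filter bu? Y) (∈-lookup p))
                              (All.lookup (All.filter⁺ bu? b) (∈-lookup p))
    injective : ∀ {p q} → proj₁ (slot p) ≡ proj₁ (slot q) → p ≡ q
    injective {p} {q} e with p Fin.≟ q
    ... | yes p≡q = p≡q
    ... | no  p≢q = contradiction (trans (proj₂ (slot p)) (trans (cong g e) (sym (proj₂ (slot q)))))
                      (lookup-pair (λ n → n ∘ sym) (AllPairs.filter⁺ bu? s) p q p≢q)

  and-map : ∀ {n} (f : Fin n → Bool) → and (map f (allFin n)) ≡ true → ∀ i → f i ≡ true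
  and-map f e i = elim (allFin _) e (∈-allFin i)
    where
    elim : ∀ xs → and (map f xs) ≡ true → ∀ {i} → i ∈ xs → f i ≡ true
    elim (x ∷ xs) e m with f x in eq
    elim (x ∷ xs) e (here refl) | true = eq
    elim (x ∷ xs) e (there m)   | true = elim xs e m

  and-map⁺ : ∀ {n} (f : Fin n → Bool) → (∀ i → f i ≡ true) → and (map f (allFin n)) ≡ true
  and-map⁺ f all = intro (allFin _)
    where
    intro : ∀ xs → and (map f xs) ≡ true
    intro []       = refl
    intro (x ∷ xs) rewrite all x = intro xs

  bu-elim : ∀ l → isBU Up w v l ≡ true → ∀ i j → i ≢ w → j ≢ w → adj Up (to l i) (to l j) ≡ adj Up i j
  bu-elim l e i j i≢w j≢w = agree (adj Up (to l i) (to l j)) (adj Up i j)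
    (trans (sym (cong₂ (λ p q → p ∨ q ∨ not (adj Up (to l i) (to l j) xor adj Up i j))
                  (dec-false (i Fin.≟ w) i≢w) (dec-false (j Fin.≟ w) j≢w)))
           (and-map _ (and-map _ e i) j))
    where
    agree : ∀ a b → not (a xor b) ≡ true → a ≡ b
    agree false false _ = refl
    agree true  true  _ = refl

  aut⇒bu : ∀ l → IsAut Up l → isBU Up w v l ≡ true
  aut⇒bu l aut = and-map⁺ _ (λ i → and-map⁺ _ (λ j → test (does (i Fin.≟ w)) (does (j Fin.≟ w)) (aut i j)))
    where
    test : ∀ p q {a b} → a ≡ b → p ∨ q ∨ not (a xor b) ≡ true
    test true  q     e            = refl
    test false true  e            = refl
    test false false {false} refl = refl
    test false false {true}  refl = refl

  -- The last hypothesis does double duty. It bounds the count of every competing saturating set by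
  -- `K`, which the base already attains; and it makes each automorphism conflict with a base
  -- element, so the completion can only add non-automorphisms.
  optimum-extending :
    (∀ l → IsAut Up l → to l w ≢ v) →
    (∀ l → isBU Up w v l ≡ true → InB Up w v l → IsAut Up l) →
    ∀ {K} (base : Fin K → Perm N) →
    (∀ k → IsAut Up (base k)) →
    (∀ {k k′} → k ≢ k′ → Separated (base k) (base k′)) →
    (Σ (Fin K) λ k → base k ≈ₚ idPerm) →
    ((∀ l → IsAut Up l → Σ (Fin K) λ k → from l v ≡ from (base k) v) ⊎
     (∀ l → IsAut Up l → Σ (Fin K) λ k → to l w ≡ to (base k) w)) →
    Σ (List (Perm N)) λ Xs → Optimum Up w v Xs
      × (∀ l → l ∈ Xs → IsAut Up l → Σ (Fin K) λ k → l ≈ₚ base k)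
      × (∀ k → Σ (Perm N) λ μ → μ ∈ Xs × μ ≈ₚ base k)
  optimum-extending aut-w bu⇒aut {K} base aut sep (k₀ , base≈id) hits =
    carrier , (maxsat , best) , only , (λ k → base k , extends (∈-tabulate⁺ k) , λ _ → refl)
    where
    aut-inB : ∀ l → IsAut Up l → InB Up w v l
    aut-inB l al = aut-w l al , λ i j _ _ _ _ → al i j

    open Completion (complete (allFin N) (tabulate base)
           (All.tabulate⁺ (λ k → aut-inB (base k) (aut k)))
           (AllPairs.tabulate⁺ (λ {k} {k′} → sep {k} {k′})))

    maxsat : MaxSat Up w v carrier
    maxsat = (base k₀ , extends (∈-tabulate⁺ k₀) , base≈id) , inB
           , lookup-pair (λ {l} {m} → separated-sym {l} {m}) separated
           , λ σ σb _ → find (maximal σ σb (∈-allFin (from σ v)))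

    bound : ∀ Y → MaxSat Up w v Y → countBU Up w v Y ≤ K
    bound Y (_ , b , s , _) =
      [ (λ hit → countBU-bound (λ l → from l v) (λ k → from (base k) v) (λ l bu ib → hit l (bu⇒aut l bu ib))
                   Y b (AllPairs.map proj₁ pairs))
      , (λ hit → countBU-bound (λ l → to l w) (λ k → to (base k) w) (λ l bu ib → hit l (bu⇒aut l bu ib))
                   Y b (AllPairs.map proj₂ pairs)) ]′ hits
      where pairs = pairs-lookup {R = Separated} Y s

    best : ∀ Y → MaxSat Up w v Y → countBU Up w v Y ≤ countBU Up w v carrier
    best Y m = ℕ.≤-trans (bound Y m)
      (subst (_≤ countBU Up w v carrier) (countBU-tabulate base (λ k → aut⇒bu (base k) (aut k))) count)

    clash : ∀ l → IsAut Up l → Σ (Fin K) λ k → Conflict l (base k)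
    clash l al = [ (λ hit → map₂ inj₁ (hit l al)) , (λ hit → map₂ inj₂ (hit l al)) ]′ hits

    only : ∀ l → l ∈ carrier → IsAut Up l → Σ (Fin K) λ k → l ≈ₚ base k
    only l l∈ al with new l∈
    ... | inj₁ l∈Y = let (k , e) = ∈-tabulate⁻ l∈Y in k , λ i → cong (λ m → to m i) e
    ... | inj₂ s   = let (k , e) = clash l al in
                     contradiction (All.lookup s (∈-tabulate⁺ k)) (conflict⇒¬separated {l} {base k} e)

-- Integer congruences and residues

0<d∣n⇒n≡0 : ∀ {d n} → d ∣ n → ∣ n ∣ < ∣ d ∣ → n ≡ 0ℤ
0<d∣n⇒n≡0 {d} {n} d∣n n<d with ∣ n ∣ in eq
... | zero  = ℤ.∣i∣≡0⇒i≡0 eq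
... | suc k = contradiction (subst (∣ d ∣ ≤_) eq (ℕ.∣⇒≤ {{subst NonZero (sym eq) _}} (∣⇒∣ᵤ d∣n))) (ℕ.<⇒≱ n<d)

∣-resp : ∀ {d a b} → a ≡ b → d ∣ a → d ∣ b
∣-resp {d} = subst (d ∣_)

∣-swap : ∀ {d} a b → d ∣ a - b → d ∣ b - a
∣-swap a b = ∣-resp (lemma a b) ∘ ∣m⇒∣-m
  where
  lemma : ∀ a b → - (a - b) ≡ b - a
  lemma = solve-∀

∣-self : ∀ {d} a → d ∣ a - a
∣-self {d} a = divides 0ℤ (trans (ℤ.+-inverseʳ a) (sym (ℤ.*-zeroˡ d)))

∣-chain : ∀ {d} a b e → d ∣ a - b → d ∣ b - e → d ∣ a - e
∣-chain a b e p q = ∣-resp (lemma a b e) (∣m∣n⇒∣m+n p q)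
  where
  lemma : ∀ a b e → (a - b) + (b - e) ≡ a - e
  lemma = solve-∀

module _ (c : ℕ) .{{_ : NonZero c}} where

  idx≡⇒∣ : ∀ i j → idx c i ≡ idx c j → + c ∣ i - j
  idx≡⇒∣ i j e = divides (i /ℕ c - j /ℕ c) (begin
    i - j
      ≡⟨ cong₂ _-_ (a≡a%ℕn+[a/ℕn]*n i c) (a≡a%ℕn+[a/ℕn]*n j c) ⟩
    (+ (i %ℕ c) + (i /ℕ c) * + c) - (+ (j %ℕ c) + (j /ℕ c) * + c)
      ≡⟨ cong (λ r → (+ r + (i /ℕ c) * + c) - (+ (j %ℕ c) + (j /ℕ c) * + c)) remainders ⟩
    (+ (j %ℕ c) + (i /ℕ c) * + c) - (+ (j %ℕ c) + (j /ℕ c) * + c)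
      ≡⟨ lemma (+ (j %ℕ c)) (i /ℕ c) (j /ℕ c) (+ c) ⟩
    (i /ℕ c - j /ℕ c) * + c ∎)
    where
    open ≡-Reasoning
    remainders : i %ℕ c ≡ j %ℕ c
    remainders = trans (sym (Fin.toℕ-fromℕ< (n%ℕd<d i c))) (trans (cong toℕ e) (Fin.toℕ-fromℕ< (n%ℕd<d j c)))
    lemma : ∀ r a b c → (r + a * c) - (r + b * c) ≡ (a - b) * c
    lemma = solve-∀

  ∣-remainder : ∀ i → + c ∣ i - + (i %ℕ c)
  ∣-remainder i = divides (i /ℕ c)
    (trans (cong (_- + (i %ℕ c)) (a≡a%ℕn+[a/ℕn]*n i c)) (lemma (+ (i %ℕ c)) ((i /ℕ c) * + c)))
    where
    lemma : ∀ r q → (r + q) - r ≡ q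
    lemma = solve-∀

  congruent-below : ∀ {r s} → r < c → s < c → + c ∣ + r - + s → r ≡ s
  congruent-below {r} {s} r<c s<c d = ℤ.+-injective (ℤ.i-j≡0⇒i≡j (+ r) (+ s) (0<d∣n⇒n≡0 d small))
    where
    small : ∣ + r - + s ∣ < c
    small = ℕ.≤-<-trans (subst (λ z → ∣ z ∣ ≤ r ℕ.⊔ s) (sym (ℤ.m-n≡m⊖n r s)) (ℤ.∣m⊝n∣≤m⊔n r s))
                        (ℕ.⊔-lub r<c s<c)

  ∣⇒idx≡ : ∀ i j → + c ∣ i - j → idx c i ≡ idx c j
  ∣⇒idx≡ i j d = Fin.fromℕ<-cong _ _
    (congruent-below (n%ℕd<d i c) (n%ℕd<d j c)
      (∣-chain (+ (i %ℕ c)) i (+ (j %ℕ c)) (∣-swap i (+ (i %ℕ c)) (∣-remainder i)) (∣-chain i j (+ (j %ℕ c)) d (∣-remainder j))))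
    (n%ℕd<d i c) (n%ℕd<d j c)

  idx-toℕ : ∀ (i : Fin c) → idx c (+ toℕ i) ≡ i
  idx-toℕ i = Fin.toℕ-injective (trans (Fin.toℕ-fromℕ< _) (ℕ.m<n⇒m%n≡m (Fin.toℕ<n i)))

-- Cycle and leaf coordinates with integer indices

module Sunny {N : ℕ} {Up : Graph N} {w v : Fin N} (L : Labelling Up w v) where

  instance
    c-NonZero : NonZero (c L)
    c-NonZero = c-nz L

  infix 4 _≋_
  _≋_ : ℤ → ℤ → Set
  i ≋ j = + c L ∣ i - j

  leaf-cong : ∀ {a b} {j : Fin (deg Up (x L a) ∸ 2)} {k : Fin (deg Up (x L b) ∸ 2)} →
              a ≡ b → toℕ j ≡ toℕ k → leaf L a j ≡ leaf L b k
  leaf-cong refl e = cong (leaf L _) (Fin.toℕ-injective e)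

  -- Opaque, because unification would otherwise unfold integer remainders.
  opaque
    cyc : ℤ → Fin N
    cyc = X L

    cyc≡X : ∀ i → cyc i ≡ X L i
    cyc≡X i = refl

    cyc-cong : ∀ i j → i ≋ j → cyc i ≡ cyc j
    cyc-cong i j = cong (x L) ∘ ∣⇒idx≡ (c L) i j

    cyc-inj : ∀ i j → cyc i ≡ cyc j → i ≋ j
    cyc-inj i j = idx≡⇒∣ (c L) i j ∘ x-inj L _ _

    2≤deg-cyc : ∀ i → 2 ≤ deg Up (cyc i)
    2≤deg-cyc i = x-skel L (idx (c L) i)

    on-cyc : ∀ u → 2 ≤ deg Up u → Σ ℤ λ k → u ≡ cyc k
    on-cyc u d = let (k , e) = x-all L u d in + toℕ k , trans (sym e) (cong (x L) (sym (idx-toℕ (c L) k)))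

  leaves : ℤ → ℕ
  leaves i = deg Up (cyc i) ∸ 2

  opaque
    unfolding cyc

    lf : ∀ i j → j < leaves i → Fin N
    lf i j p = leaf L (idx (c L) i) (fromℕ< p)

    lf-cong : ∀ i i′ {j j′} p p′ → i ≋ i′ → j ≡ j′ → lf i j p ≡ lf i′ j′ p′
    lf-cong i i′ p p′ d e =
      leaf-cong (∣⇒idx≡ (c L) i i′ d) (trans (Fin.toℕ-fromℕ< p) (trans e (sym (Fin.toℕ-fromℕ< p′))))

    lf-inj : ∀ i i′ {j j′} p p′ → lf i j p ≡ lf i′ j′ p′ → i ≋ i′ × j ≡ j′
    lf-inj i i′ p p′ e = let (a , b) = leaf-inj L _ _ _ _ e in
      idx≡⇒∣ (c L) i i′ a , trans (sym (Fin.toℕ-fromℕ< p)) (trans b (Fin.toℕ-fromℕ< p′))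

    deg-lf : ∀ i j p → deg Up (lf i j p) ≡ 1
    deg-lf i j p = leaf-deg L _ _

    cyc-lf-adj : ∀ i k j p → i ≋ k → adj Up (cyc i) (lf k j p) ≡ true
    cyc-lf-adj i k j p d =
      subst (λ u → adj Up u (lf k j p) ≡ true) (sym (cyc-cong i k d)) (leaf-adj L (idx (c L) k) (fromℕ< p))

    0<leaves : 0 < leaves 0ℤ
    0<leaves = ℕ.≤-<-trans z≤n (Fin.toℕ<n (proj₁ (w-lab L)))

    w≡lf : w ≡ lf 0ℤ 0 0<leaves
    w≡lf = let (j , j≡0 , e) = w-lab L in
      trans (sym e) (leaf-cong refl (trans j≡0 (sym (Fin.toℕ-fromℕ< 0<leaves))))

  -- A view with integer indices, on which maps such as i ↦ α-i can be written directly. A vertex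
  -- has one position for each representative of its index modulo c, so a map defined on positions
  -- needs a proof of independence.
  data Position : Fin N → Set where
    on-cycle : ∀ i → Position (cyc i)
    on-leaf  : ∀ i j p → Position (lf i j p)

  opaque
    unfolding cyc lf

    position : ∀ u → Position u
    position u with cover L u
    ... | inj₁ (i , refl) = subst (Position ∘ x L) (idx-toℕ (c L) i) (on-cycle (+ toℕ i))
    ... | inj₂ (i , j , refl) = subst Position (leaf-cong (idx-toℕ (c L) i) (Fin.toℕ-fromℕ< p)) (on-leaf (+ toℕ i) (toℕ j) p)
      where
      p : toℕ j < leaves (+ toℕ i)
      p = subst (λ a → toℕ j < deg Up (x L a) ∸ 2) (sym (idx-toℕ (c L) i)) (Fin.toℕ<n j)

  deg1≢cyc : ∀ {u} i → deg Up u ≡ 1 → u ≢ cyc i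
  deg1≢cyc i d refl with s≤s () ← subst (2 ≤_) d (2≤deg-cyc i)

  lf≢cyc : ∀ i j p k → lf i j p ≢ cyc k
  lf≢cyc i j p k = deg1≢cyc k (deg-lf i j p)

  w-deg : deg Up w ≡ 1
  w-deg = trans (cong (deg Up) w≡lf) (deg-lf 0ℤ 0 0<leaves)

  cyc≢w : ∀ i → cyc i ≢ w
  cyc≢w i e = deg1≢cyc i w-deg (sym e)

  lf-neighbour : ∀ {u} k j p → adj Up u (lf k j p) ≡ true → u ≡ cyc k
  lf-neighbour {u} k j p a = leaf-neighbour Up (deg-lf k j p)
    (trans (Graph.sym Up _ _) a) (trans (Graph.sym Up _ _) (cyc-lf-adj k k j p (∣-self k)))

  cyc-w-adj : adj Up (cyc 0ℤ) w ≡ true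
  cyc-w-adj = subst (λ u → adj Up (cyc 0ℤ) u ≡ true) (sym w≡lf) (cyc-lf-adj 0ℤ 0ℤ 0 0<leaves (∣-self 0ℤ))

  w-neighbour : ∀ {u} → adj Up u w ≡ true → u ≡ cyc 0ℤ
  w-neighbour {u} a = lf-neighbour 0ℤ 0 0<leaves (subst (λ z → adj Up u z ≡ true) w≡lf a)

  Neighbours : ℤ → ℤ → Set
  Neighbours i k = (k ≋ i + 1ℤ) ⊎ (i ≋ k + 1ℤ)

  opaque
    unfolding cyc

    cyc-adj⇒ : ∀ i k → adj Up (cyc i) (cyc k) ≡ true → Neighbours i k
    cyc-adj⇒ i k a = [ inj₁ ∘ idx≡⇒∣ (c L) k (i + 1ℤ) , inj₂ ∘ idx≡⇒∣ (c L) i (k + 1ℤ) ]′ (Equivalence.to (x-adj L i k) a)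

    cyc-adj⇐ : ∀ i k → Neighbours i k → adj Up (cyc i) (cyc k) ≡ true
    cyc-adj⇐ i k = Equivalence.from (x-adj L i k) ∘
      [ inj₁ ∘ ∣⇒idx≡ (c L) k (i + 1ℤ) , inj₂ ∘ ∣⇒idx≡ (c L) i (k + 1ℤ) ]′

  -- Rotations and reflections of the cycle

  ¬c∣2 : ¬ (+ c L ∣ + 2)
  ¬c∣2 d with () ← 0<d∣n⇒n≡0 d (c≥3 L)

  -- A common interface to i ↦ α+i and i ↦ α-i. `next` ends in an unordered neighbour relation
  -- because a reflection reverses the direction of the cycle.
  record Dihedral (ρ : ℤ → ℤ) : Set where
    field
      preserves  : ∀ i k → i ≋ k → ρ i ≋ ρ k
      reflects   : ∀ i k → ρ i ≋ ρ k → i ≋ k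
      surjective : ∀ k → Σ ℤ λ i → ρ i ≡ k
      next       : ∀ i k → k ≋ i + 1ℤ → Neighbours (ρ i) (ρ k)
      next⁻¹     : ∀ i k → ρ k ≋ ρ i + 1ℤ → Neighbours i k

    neighbours : ∀ i k → Neighbours i k → Neighbours (ρ i) (ρ k)
    neighbours i k = [ next i k , swap ∘ next k i ]′

    neighbours⁻¹ : ∀ i k → Neighbours (ρ i) (ρ k) → Neighbours i k
    neighbours⁻¹ i k = [ next⁻¹ i k , swap ∘ next⁻¹ k i ]′

  rotation-dihedral : ∀ α → Dihedral (λ i → α + i)
  rotation-dihedral α = record
    { preserves  = λ i k → ∣-resp (shift α i k)
    ; reflects   = λ i k → ∣-resp (sym (shift α i k))
    ; surjective = λ k → (k - α) , cancel α k
    ; next       = λ i k → inj₁ ∘ ∣-resp (advance α i k)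
    ; next⁻¹     = λ i k → inj₁ ∘ ∣-resp (sym (advance α i k)) }
    where
    shift : ∀ α i k → i - k ≡ (α + i) - (α + k)
    shift = solve-∀
    cancel : ∀ α k → α + (k - α) ≡ k
    cancel = solve-∀
    advance : ∀ α i k → k - (i + 1ℤ) ≡ (α + k) - ((α + i) + 1ℤ)
    advance = solve-∀

  reflection-dihedral : ∀ α → Dihedral (λ i → α - i)
  reflection-dihedral α = record
    { preserves  = λ i k → ∣-resp (shift α i k) ∘ ∣-swap i k
    ; reflects   = λ i k → ∣-swap k i ∘ ∣-resp (sym (shift α i k))
    ; surjective = λ k → (α - k) , cancel α k
    ; next       = λ i k → inj₂ ∘ ∣-resp (advance α i k)
    ; next⁻¹     = λ i k → inj₂ ∘ ∣-resp (sym (advance α k i)) }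
    where
    shift : ∀ α i k → k - i ≡ (α - i) - (α - k)
    shift = solve-∀
    cancel : ∀ α k → α - (α - k) ≡ k
    cancel = solve-∀
    advance : ∀ α i k → k - (i + 1ℤ) ≡ (α - i) - ((α - k) + 1ℤ)
    advance = solve-∀

  -- Adjacency depends only on the indices of the two vertices and on which of them are leaves.
  -- Hence leaves at `i` may go to leaves at `ρ i` in any order.
  dihedral-aut : ∀ l {ρ} → Dihedral ρ → (∀ i → to l (cyc i) ≡ cyc (ρ i)) →
    (∀ i j p → Σ ℕ λ j′ → Σ (j′ < leaves (ρ i)) λ p′ → to l (lf i j p) ≡ lf (ρ i) j′ p′) → IsAut Up l
  dihedral-aut l {ρ} dih on-cyc on-lf a b = go (position a) (position b)
    where
    open Dihedral dih
    mixed : ∀ i k j p → adj Up (to l (cyc i)) (to l (lf k j p)) ≡ adj Up (cyc i) (lf k j p)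
    mixed i k j p with on-lf k j p
    ... | j′ , p′ , e rewrite e | on-cyc i = bool-ext
      (λ h → cyc-lf-adj i k j p (reflects i k (cyc-inj (ρ i) (ρ k) (lf-neighbour (ρ k) j′ p′ h))))
      (λ h → cyc-lf-adj (ρ i) (ρ k) j′ p′ (preserves i k (cyc-inj i k (lf-neighbour k j p h))))
    go : ∀ {a b} → Position a → Position b → adj Up (to l a) (to l b) ≡ adj Up a b
    go (on-cycle i) (on-cycle k) rewrite on-cyc i | on-cyc k = bool-ext
      (cyc-adj⇐ i k ∘ neighbours⁻¹ i k ∘ cyc-adj⇒ (ρ i) (ρ k))
      (cyc-adj⇐ (ρ i) (ρ k) ∘ neighbours i k ∘ cyc-adj⇒ i k)
    go (on-cycle i) (on-leaf k j p) = mixed i k j p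
    go (on-leaf k j p) (on-cycle i) = trans (Graph.sym Up _ _) (trans (mixed i k j p) (Graph.sym Up _ _))
    go (on-leaf i j p) (on-leaf k j′ p′) with on-lf i j p | on-lf k j′ p′
    ... | m , q , e | m′ , q′ , e′ rewrite e | e′ = bool-ext
      (λ h → contradiction (lf-neighbour (ρ k) m′ q′ h) (lf≢cyc (ρ i) m q (ρ k)))
      (λ h → contradiction (lf-neighbour k j′ p′ h) (lf≢cyc i j p k))

  RotatesBy ReflectsBy : ℤ → Perm N → Set
  RotatesBy  α l = ∀ i → to l (cyc i) ≡ cyc (α + i)
  ReflectsBy α l = ∀ i → to l (cyc i) ≡ cyc (α - i)

  -- Only edges of the cycle have to be preserved, and only forwards. This covers members of B_U,
  -- for which nothing is known about the edge at w, along with automorphisms.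
  module Classify (l : Perm N)
    (pres : ∀ i k → adj Up (cyc i) (cyc k) ≡ true → adj Up (to l (cyc i)) (to l (cyc k)) ≡ true) where

    image : ∀ i → Σ ℤ λ k → to l (cyc i) ≡ cyc k
    image i = on-cyc (to l (cyc i)) (two-neighbours Up
      (pres i (i + 1ℤ) (cyc-adj⇐ i (i + 1ℤ) (inj₁ (∣-self (i + 1ℤ)))))
      (pres i (i - 1ℤ) (cyc-adj⇐ i (i - 1ℤ) (inj₂ (∣-resp (back i) (∣-self i)))))
      -- Here c ≥ 3 enters: the two cycle neighbours of x_i are distinct, so the image of x_i has
      -- degree at least 2 and lies on the cycle.
      (λ e → ¬c∣2 (∣-resp (gap i) (cyc-inj (i + 1ℤ) (i - 1ℤ) (to-injective l e)))))
      where
      back : ∀ i → i - i ≡ i - ((i - 1ℤ) + 1ℤ)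
      back = solve-∀
      gap : ∀ i → (i + 1ℤ) - (i - 1ℤ) ≡ + 2
      gap = solve-∀

    neighbour-step : ∀ s → s ≡ 1ℤ ⊎ s ≡ -1ℤ → ∀ i {y z} → to l (cyc i) ≡ cyc y → to l (cyc (i + 1ℤ)) ≡ cyc z →
                     (z ≋ y + s) ⊎ (z ≋ y - s)
    neighbour-step s s≡±1 i {y} {z} ey ez =
      orient s s≡±1 (cyc-adj⇒ y z (subst (_≡ true) (cong₂ (adj Up) ey ez)
        (pres i (i + 1ℤ) (cyc-adj⇐ i (i + 1ℤ) (inj₁ (∣-self (i + 1ℤ)))))))
      where
      backward : ∀ y z → (z + 1ℤ) - y ≡ z - (y - 1ℤ)
      backward = solve-∀
      orient : ∀ s → s ≡ 1ℤ ⊎ s ≡ -1ℤ → Neighbours y z → (z ≋ y + s) ⊎ (z ≋ y - s)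
      orient _ (inj₁ refl) = [ inj₁ , inj₂ ∘ ∣-resp (backward y z) ∘ ∣-swap y (z + 1ℤ) ]′
      orient _ (inj₂ refl) = [ inj₂ , inj₁ ∘ ∣-resp (backward y z) ∘ ∣-swap y (z + 1ℤ) ]′

    module _ (s : ℤ) (s≡±1 : s ≡ 1ℤ ⊎ s ≡ -1ℤ) (a : ℤ)
      (e₀ : to l (cyc 0ℤ) ≡ cyc a) (e₁ : to l (cyc 1ℤ) ≡ cyc (a + s)) where

      Agrees : ℤ → Set
      Agrees i = to l (cyc i) ≡ cyc (a + s * i)

      -- The image of the next vertex is a neighbour of the current image. Turning back would give
      -- x_i and x_(i+2) the same image, so the walk keeps its direction `s`.
      agrees-suc : ∀ i → Agrees i → Agrees (i + 1ℤ) → Agrees (i + 1ℤ + 1ℤ)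
      agrees-suc i p q with image (i + 1ℤ + 1ℤ)
      ... | z , ez = [ (λ d → trans ez (trans (cyc-cong z _ d) (cong cyc (forward a s i))))
                     , (λ d → contradiction
                         (∣-resp (gap i) (cyc-inj (i + 1ℤ + 1ℤ) i (to-injective l
                           (trans ez (trans (cyc-cong z _ d) (trans (cong cyc (backward a s i)) (sym p)))))))
                         ¬c∣2) ]′
                     (neighbour-step s s≡±1 (i + 1ℤ) {a + s * (i + 1ℤ)} {z} q ez)
        where
        forward : ∀ a s i → (a + s * (i + 1ℤ)) + s ≡ a + s * (i + 1ℤ + 1ℤ)
        forward = solve-∀
        backward : ∀ a s i → (a + s * (i + 1ℤ)) - s ≡ a + s * i
        backward = solve-∀
        gap : ∀ i → (i + 1ℤ + 1ℤ) - i ≡ + 2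
        gap = solve-∀

      along : ∀ n → Agrees (+ n) × Agrees (+ n + 1ℤ)
      along zero = trans e₀ (cong cyc (lemma₀ a s)) , trans e₁ (cong cyc (lemma₁ a s))
        where
        lemma₀ : ∀ a s → a ≡ a + s * 0ℤ
        lemma₀ = solve-∀
        lemma₁ : ∀ a s → a + s ≡ a + s * (0ℤ + 1ℤ)
        lemma₁ = solve-∀
      along (suc n) with along n
      ... | p , q = subst Agrees suc-n q , subst (λ i → Agrees (i + 1ℤ)) suc-n (agrees-suc (+ n) p q)
        where
        suc-n : + n + 1ℤ ≡ + suc n
        suc-n = cong +_ (ℕ.+-comm n 1)

      everywhere : ∀ i → to l (cyc i) ≡ cyc (a + s * i)
      everywhere i = begin
        to l (cyc i)                 ≡⟨ cong (to l) (cyc-cong i (+ r) i≋r) ⟩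
        to l (cyc (+ r))             ≡⟨ proj₁ (along r) ⟩
        cyc (a + s * + r)            ≡⟨ cyc-cong (a + s * + r) (a + s * i)
                                          (∣-resp (lemma a s (+ r) i) (∣n⇒∣m*n s (∣-swap i (+ r) i≋r))) ⟩
        cyc (a + s * i)              ∎
        where
        open ≡-Reasoning
        r = i %ℕ c L
        i≋r = ∣-remainder (c L) i
        lemma : ∀ a s r i → s * (r - i) ≡ (a + s * r) - (a + s * i)
        lemma = solve-∀

    classify : (∃ λ α → RotatesBy α l) ⊎ (∃ λ α → ReflectsBy α l)
    classify with image 0ℤ | image 1ℤ
    ... | a , e₀ | b , e₁ with neighbour-step 1ℤ (inj₁ refl) 0ℤ {a} {b} e₀ e₁
    ...   | inj₁ d = inj₁ (a , λ i → trans (everywhere 1ℤ (inj₁ refl) a e₀ (trans e₁ (cyc-cong b (a + 1ℤ) d)) i)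
                                         (cong cyc (lemma a i)))
      where
      lemma : ∀ a i → a + 1ℤ * i ≡ a + i
      lemma = solve-∀
    ...   | inj₂ d = inj₂ (a , λ i → trans (everywhere -1ℤ (inj₂ refl) a e₀ (trans e₁ (cyc-cong b (a + -1ℤ) d)) i)
                                         (cong cyc (lemma a i)))
      where
      lemma : ∀ a i → a + -1ℤ * i ≡ a - i
      lemma = solve-∀

  aut-classify : ∀ l → IsAut Up l → (∃ λ α → RotatesBy α l) ⊎ (∃ λ α → ReflectsBy α l)
  aut-classify l aut = Classify.classify l (λ i k → trans (aut (cyc i) (cyc k)))

-- Arithmetic of exponents modulo m

+ₘ-congruent : ∀ {m} (a b : Fin m) → + m ∣ + toℕ (a +ₘ b) - (+ toℕ a + + toℕ b)
+ₘ-congruent {suc m} a b = ∣-swap (+ toℕ a + + toℕ b) (+ toℕ (a +ₘ b))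
  (subst (λ r → + suc m ∣ + (toℕ a ℕ.+ toℕ b) - + r) (sym (Fin.toℕ-fromℕ< (ℕ.m%n<n (toℕ a ℕ.+ toℕ b) (suc m)))) (∣-remainder (suc m) (+ (toℕ a ℕ.+ toℕ b))))

-ₘ-congruent : ∀ {m} (a : Fin m) → + m ∣ + toℕ (-ₘ a) - (- + toℕ a)
-ₘ-congruent {suc m} a = ∣-chain (+ toℕ (-ₘ a)) (+ (suc m ∸ toℕ a)) (- + toℕ a)
  (∣-swap (+ (suc m ∸ toℕ a)) (+ toℕ (-ₘ a))
    (subst (λ r → + suc m ∣ + (suc m ∸ toℕ a) - + r) (sym (Fin.toℕ-fromℕ< (ℕ.m%n<n (suc m ∸ toℕ a) (suc m)))) (∣-remainder (suc m) (+ (suc m ∸ toℕ a)))))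
  (∣-resp (trans (lemma (+ suc m) (+ toℕ a)) (cong (λ n → n - - + toℕ a) difference)) ∣-refl)
  where
  lemma : ∀ m a → m ≡ (m - a) - - a
  lemma = solve-∀
  difference : + suc m - + toℕ a ≡ + (suc m ∸ toℕ a)
  difference = trans (ℤ.m-n≡m⊖n (suc m) (toℕ a)) (ℤ.⊖-≥ (ℕ.<⇒≤ (Fin.toℕ<n a)))

aut-resp : ∀ {n} (G : Graph n) {l m} → l ≈ₚ m → IsAut G l → IsAut G m
aut-resp G l≈m aut i j = trans (sym (cong₂ (adj G) (l≈m i) (l≈m j))) (aut i j)

pow-+ : ∀ {n} (f : Perm n) a b → pow f (a ℕ.+ b) ≈ₚ (pow f a ∘ₚ pow f b)
pow-+ f zero    b i = refl
pow-+ f (suc a) b i = cong (to f) (pow-+ f a b i)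

-- Members of B_U are automorphisms; the group of rotation shifts

module Symmetries {N : ℕ} {Up : Graph N} {w v : Fin N} (L : Labelling Up w v) where

  open Sunny L
  open Saturating Up w v

  v≡cyc : v ≡ cyc (ν L)
  v≡cyc = trans (sym (v-lab L)) (sym (cyc≡X (ν L)))

  aut-w≢v : ∀ l → IsAut Up l → to l w ≢ v
  aut-w≢v l aut e = deg1≢cyc (ν L) (trans (deg-aut Up l aut w) w-deg) (trans e v≡cyc)

  Periodic : ℤ → Set
  Periodic α = ∀ i → deg Up (cyc (α + i)) ≡ deg Up (cyc i)

  Mirror : ℤ → Set
  Mirror α = ∀ i → deg Up (cyc (α - i)) ≡ deg Up (cyc i)

  rotation-periodic : ∀ α l → IsAut Up l → RotatesBy α l → Periodic α
  rotation-periodic α l aut rot i = trans (cong (deg Up) (sym (rot i))) (deg-aut Up l aut (cyc i))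

  reflection-mirror : ∀ α l → IsAut Up l → ReflectsBy α l → Mirror α
  reflection-mirror α l aut ref i = trans (cong (deg Up) (sym (ref i))) (deg-aut Up l aut (cyc i))

  rotatesBy : ∀ α l → (∀ i → to l (X L i) ≡ X L (α + i)) → RotatesBy α l
  rotatesBy α l h i = trans (cong (to l) (cyc≡X i)) (trans (h i) (sym (cyc≡X _)))

  rotatesBy⁻¹ : ∀ α l → RotatesBy α l → ∀ i → to l (X L i) ≡ X L (α + i)
  rotatesBy⁻¹ α l h i = trans (cong (to l) (sym (cyc≡X i))) (trans (h i) (cyc≡X _))

  module _ (l : Perm N) (pres : ∀ i j → i ≢ w → j ≢ w → adj Up (to l i) (to l j) ≡ adj Up i j)
    {ρ : ℤ → ℤ} (dih : Dihedral ρ) (act : ∀ i → to l (cyc i) ≡ cyc (ρ i)) where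

    open Dihedral dih

    w-image-is-leaf : ∀ {b} → to l w ≡ b → Position b → Σ ℤ λ β → Σ ℕ λ j → Σ (j < leaves β) λ p → to l w ≡ lf β j p
    w-image-is-leaf e (on-leaf β j p) = β , j , p , e
    w-image-is-leaf e (on-cycle k)    = let (i , ρi≡k) = surjective k in
      contradiction (to-injective l (trans (act i) (trans (cong cyc ρi≡k) (sym e)))) (cyc≢w i)

    w-edges : ∀ β {j} p → to l w ≡ lf β j p → ρ 0ℤ ≋ β → ∀ i → adj Up (to l i) (to l w) ≡ adj Up i w
    w-edges β {j} p e d i = bool-ext
      (λ h → subst (λ u → adj Up u w ≡ true) (sym (to-injective l
               (trans (lf-neighbour β j p (subst (λ u → adj Up (to l i) u ≡ true) e h))
                      (trans (sym (cyc-cong (ρ 0ℤ) β d)) (sym (act 0ℤ)))))) cyc-w-adj)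
      (λ h → subst (_≡ true) (sym (cong₂ (adj Up) (trans (cong (to l) (w-neighbour h)) (act 0ℤ)) e))
               (cyc-lf-adj (ρ 0ℤ) β j p d))

    aut-if-attached : ∀ β {j} p → to l w ≡ lf β j p → ρ 0ℤ ≋ β → IsAut Up l
    aut-if-attached β p e d i k with i Fin.≟ w | k Fin.≟ w
    ... | no i≢w   | no k≢w   = pres i k i≢w k≢w
    ... | yes refl | yes refl = trans (irrefl Up _) (sym (irrefl Up _))
    ... | no _     | yes refl = w-edges β p e d i
    ... | yes refl | no _     = trans (Graph.sym Up _ _) (trans (w-edges β p e d k) (Graph.sym Up _ _))

    -- Comparing positions 0 and α suffices. If λ(w) hangs elsewhere, then d(x_0) = d(x_ρ(0)) + 1,
    -- because x_0 loses w and x_ρ(0) gains no leaf in its place; at α nothing is lost, so d(x_α) ≤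
    -- d(x_ρ(α)). Periodicity identifies the two pairs of degrees.
    attached : ∀ α → Periodic α → ¬ (α ≋ 0ℤ) → deg Up (cyc (ρ α)) ≡ deg Up (cyc (ρ 0ℤ)) →
               ∀ β {j} p → to l w ≡ lf β j p → ρ 0ℤ ≋ β
    attached α periodic α≢0 deg-ρα β {j} p e with + c L ∣? (ρ 0ℤ - β)
    ... | yes d = d
    ... | no ¬d = contradiction too-big ℕ.1+n≰n
      where
      image-deg : ∀ i → deg Up (cyc (ρ i)) ℕ.+ indicator (adj Up (cyc i) w) ≡
                        deg Up (cyc i) ℕ.+ indicator (adj Up (cyc (ρ i)) (lf β j p))
      image-deg i = subst (λ u → deg Up u ℕ.+ _ ≡ _ ℕ.+ indicator (adj Up u (lf β j p))) (act i)
        (subst (λ u → _ ≡ deg Up (cyc i) ℕ.+ indicator (adj Up (to l (cyc i)) u)) e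
          (deg-of-card-iso Up l pres (cyc i) (cyc≢w i)))

      detached : adj Up (cyc (ρ 0ℤ)) (lf β j p) ≡ false
      detached = Bool.¬-not (λ h → ¬d (cyc-inj (ρ 0ℤ) β (lf-neighbour β j p h)))

      α-w : adj Up (cyc α) w ≡ false
      α-w = Bool.¬-not (λ h → α≢0 (cyc-inj α 0ℤ (w-neighbour h)))

      too-big : suc (deg Up (cyc (ρ 0ℤ))) ≤ deg Up (cyc (ρ 0ℤ))
      too-big = begin
        suc (deg Up (cyc (ρ 0ℤ)))                                      ≡⟨ ℕ.+-comm 1 _ ⟩
        deg Up (cyc (ρ 0ℤ)) ℕ.+ 1                                      ≡⟨ cong (λ b → deg Up (cyc (ρ 0ℤ)) ℕ.+ indicator b) (sym cyc-w-adj) ⟩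
        deg Up (cyc (ρ 0ℤ)) ℕ.+ indicator (adj Up (cyc 0ℤ) w)          ≡⟨ image-deg 0ℤ ⟩
        deg Up (cyc 0ℤ) ℕ.+ indicator (adj Up (cyc (ρ 0ℤ)) (lf β j p)) ≡⟨ cong (λ b → deg Up (cyc 0ℤ) ℕ.+ indicator b) detached ⟩
        deg Up (cyc 0ℤ) ℕ.+ 0                                          ≡⟨ ℕ.+-identityʳ _ ⟩
        deg Up (cyc 0ℤ)                                                ≡⟨ periodic 0ℤ ⟨
        deg Up (cyc (α + 0ℤ))                                          ≡⟨ cong (deg Up ∘ cyc) (ℤ.+-identityʳ α) ⟩
        deg Up (cyc α)                                                 ≤⟨ ℕ.m≤m+n _ _ ⟩
        deg Up (cyc α) ℕ.+ indicator (adj Up (cyc (ρ α)) (lf β j p))   ≡⟨ image-deg α ⟨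
        deg Up (cyc (ρ α)) ℕ.+ indicator (adj Up (cyc α) w)            ≡⟨ cong (λ b → deg Up (cyc (ρ α)) ℕ.+ indicator b) α-w ⟩
        deg Up (cyc (ρ α)) ℕ.+ 0                                       ≡⟨ ℕ.+-identityʳ _ ⟩
        deg Up (cyc (ρ α))                                             ≡⟨ deg-ρα ⟩
        deg Up (cyc (ρ 0ℤ))                                            ∎
        where open ℕ.≤-Reasoning

    card-iso-aut : ∀ α → Periodic α → ¬ (α ≋ 0ℤ) → deg Up (cyc (ρ α)) ≡ deg Up (cyc (ρ 0ℤ)) → IsAut Up l
    card-iso-aut α periodic α≢0 deg-ρα =
      let (β , j , p , e) = w-image-is-leaf refl (position (to l w))
      in aut-if-attached β p e (attached α periodic α≢0 deg-ρα β p e)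

  bu⇒aut : ∀ α → Periodic α → ¬ (α ≋ 0ℤ) → ∀ l → isBU Up w v l ≡ true → IsAut Up l
  bu⇒aut α periodic α≢0 l bu =
    [ (λ (a , rot) → card-iso-aut l pres (rotation-dihedral a) rot α periodic α≢0
        (trans (cong (deg Up ∘ cyc) (swap-sum a α)) (periodic (a + 0ℤ))))
    -- For a reflection ρ(α) lies one period before ρ(0), so periodicity is applied at `a - α`.
    , (λ (a , ref) → card-iso-aut l pres (reflection-dihedral a) ref α periodic α≢0
        (trans (sym (periodic (a - α))) (cong (deg Up ∘ cyc) (cancel α a)))) ]′
    (Classify.classify l (λ i k → trans (pres (cyc i) (cyc k) (cyc≢w i) (cyc≢w k))))
    where
    pres = bu-elim l bu
    swap-sum : ∀ a α → a + α ≡ α + (a + 0ℤ)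
    swap-sum = solve-∀
    cancel : ∀ α a → α + (a - α) ≡ a - 0ℤ
    cancel = solve-∀

  -- The shifts realised by rotational automorphisms form a subgroup of the integers; the lemmas
  -- below identify `δ` as its positive generator.
  Rot : ℤ → Set
  Rot α = Σ (Perm N) λ l → IsAut Up l × RotatesBy α l

  rot-+ : ∀ α β → Rot α → Rot β → Rot (α + β)
  rot-+ α β (l , la , lr) (m , ma , mr) = l ∘ₚ m , ∘-aut Up l m la ma , λ i →
    trans (cong (to l) (mr i)) (trans (lr _) (cong cyc (sym (ℤ.+-assoc α β i))))

  rot-neg : ∀ α → Rot α → Rot (- α)
  rot-neg α (l , la , lr) = invₚ l , inv-aut Up l la , λ i →
    from-of l (trans (lr _) (cong cyc (lemma α i)))
    where
    lemma : ∀ α i → α + (- α + i) ≡ i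
    lemma = solve-∀

  rot-0 : Rot 0ℤ
  rot-0 = idPerm , (λ _ _ → refl) , λ i → cong cyc (sym (ℤ.+-identityˡ i))

  -- The identity is read as a full turn, which is how δ ∣ c is obtained later.
  rot-c : Rot (+ c L)
  rot-c = idPerm , (λ _ _ → refl) , λ i → cyc-cong i (+ c L + i) (∣-swap (+ c L + i) i (∣-resp (lemma (+ c L) i) ∣-refl))
    where
    lemma : ∀ c i → c ≡ (c + i) - i
    lemma = solve-∀

  rot-ℕ* : ∀ α → Rot α → ∀ n → Rot (+ n * α)
  rot-ℕ* α r zero    = subst Rot (sym (ℤ.*-zeroˡ α)) rot-0
  rot-ℕ* α r (suc n) = subst Rot (lemma (+ n) α) (rot-+ α (+ n * α) r (rot-ℕ* α r n))
    where
    lemma : ∀ n α → α + n * α ≡ (1ℤ + n) * α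
    lemma = solve-∀

  rot-* : ∀ α → Rot α → ∀ n → Rot (n * α)
  rot-* α r (+ n)        = rot-ℕ* α r n
  rot-* α r ℤ.-[1+ n ] = subst Rot (ℤ.neg-distribˡ-* (+ suc n) α) (rot-neg (+ suc n * α) (rot-ℕ* α r (suc n)))

  rot-periodic : ∀ α → Rot α → Periodic α
  rot-periodic α (l , la , lr) = rotation-periodic α l la lr

  reflections-compose : ∀ α β l m → IsAut Up l → IsAut Up m → ReflectsBy α l → ReflectsBy β m → Rot (α - β)
  reflections-compose α β l m la ma lr mr = l ∘ₚ m , ∘-aut Up l m la ma , λ i →
    trans (cong (to l) (mr i)) (trans (lr _) (cong cyc (lemma α β i)))
    where
    lemma : ∀ α β i → α - (β - i) ≡ (α - β) + i
    lemma = solve-∀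

  module _ (δ : ℕ) {{_ : NonZero δ}} (isδ : IsDelta L δ) where

    rot-δ : Rot (+ δ)
    rot-δ =
      let (_ , (l , la , (α , lr) , l0) , _) = isδ
          α≋δ = cyc-inj (α + 0ℤ) (+ δ) (trans (cyc≡X _) (trans (sym (lr 0ℤ)) (trans l0 (sym (cyc≡X _)))))
      in l , la , λ i →
        trans (rotatesBy α l lr i) (cyc-cong (α + i) (+ δ + i) (∣-resp (lemma α (+ δ) i) α≋δ))
      where
      lemma : ∀ α δ i → (α + 0ℤ) - δ ≡ (α + i) - (δ + i)
      lemma = solve-∀

    -- The remainder of `α` modulo `δ` is again a realised shift, and a positive one would
    -- contradict the minimality of `δ`.
    δ∣rot : ∀ α → Rot α → + δ ∣ α
    δ∣rot α r = small (α %ℕ δ) (n%ℕd<d α δ) (a≡a%ℕn+[a/ℕn]*n α δ)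
      (subst Rot (trans (cong (_+ - ((α /ℕ δ) * + δ)) (a≡a%ℕn+[a/ℕn]*n α δ)) (lemma (+ (α %ℕ δ)) ((α /ℕ δ) * + δ)))
        (rot-+ α (- ((α /ℕ δ) * + δ)) r (rot-neg ((α /ℕ δ) * + δ) (rot-* (+ δ) rot-δ (α /ℕ δ)))))
      where
      lemma : ∀ r q → (r + q) - q ≡ r
      lemma = solve-∀
      small : ∀ r → r < δ → α ≡ + r + (α /ℕ δ) * + δ → Rot (+ r) → + δ ∣ α
      small zero    _   e _ = divides (α /ℕ δ) (trans e (ℤ.+-identityˡ _))
      small (suc r) r<δ _ (l , la , lr) = contradiction
        (proj₂ (proj₂ isδ) (suc r) (s≤s z≤n)
          (l , la , (+ suc r , rotatesBy⁻¹ (+ suc r) l lr)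
             , trans (rotatesBy⁻¹ (+ suc r) l lr 0ℤ) (cong (X L) (ℤ.+-identityʳ (+ suc r)))))
        (ℕ.<⇒≱ r<δ)

-- The powers of φ

module WithPhi {N : ℕ} {Up : Graph N} {w v : Fin N} (L : Labelling Up w v)
  (δ : ℕ) {{δ-nz : NonZero δ}} (isδ : IsDelta L δ) (φ : Perm N) (isφ : IsPhi L δ φ) where

  open Sunny L
  open Symmetries L
  open Saturating Up w v

  m : ℕ
  m = c L / δ

  c≡m*δ : + c L ≡ + m * + δ
  c≡m*δ = trans (cong +_ (sym (ℕ.m/n*n≡m (∣⇒∣ᵤ (δ∣rot δ isδ (+ c L) rot-c))))) (ℤ.pos-* m δ)

  δ∣c : + δ ∣ + c L
  δ∣c = divides (+ m) c≡m*δ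

  ≋⇒δ∣ : ∀ {i j} → i ≋ j → + δ ∣ i - j
  ≋⇒δ∣ = ∣-trans δ∣c

  instance
    m-NonZero : NonZero m
    m-NonZero = ℕ.≢-nonZero λ m≡0 → ℕ.≢-nonZero⁻¹ (c L)
      (ℤ.+-injective (trans c≡m*δ (trans (cong (λ k → + k * + δ) m≡0) (ℤ.*-zeroˡ (+ δ)))))

  scale : ∀ n → + m ∣ n → + c L ∣ n * + δ
  scale n (divides q e) = divides q (begin
    n * + δ             ≡⟨ cong (_* + δ) e ⟩
    q * + m * + δ       ≡⟨ ℤ.*-assoc q (+ m) (+ δ) ⟩
    q * (+ m * + δ)     ≡⟨ cong (q *_) c≡m*δ ⟨
    q * + c L           ∎)
    where open ≡-Reasoning

  unscale : ∀ n → + c L ∣ n * + δ → + m ∣ n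
  unscale n d = *-cancelʳ-∣ (+ δ) {{δ-nz}} (subst (_∣ n * + δ) c≡m*δ d)

  shift : ℕ → ℤ
  shift k = + k * + δ

  opaque
    -- As c = m·δ, the quotient of `β` by `δ` matters only modulo m, and its residue is the exponent
    -- sought.
    residue : ∀ β → + δ ∣ β → Σ (Fin m) λ k → shift (toℕ k) ≋ β
    residue β (divides q e) = idx m q , ∣-resp (trans (lemma (+ toℕ (idx m q)) q (+ δ)) (cong (λ β′ → shift (toℕ (idx m q)) - β′) (sym e)))
      (scale (+ toℕ (idx m q) - q) (idx≡⇒∣ m (+ toℕ (idx m q)) q (idx-toℕ m (idx m q))))
      where
      lemma : ∀ k q d → (k - q) * d ≡ k * d - q * d
      lemma = solve-∀

  shift-inj : ∀ (a b : Fin m) → shift (toℕ a) ≋ shift (toℕ b) → a ≡ b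
  shift-inj a b d = Fin.toℕ-injective (congruent-below m (Fin.toℕ<n a) (Fin.toℕ<n b)
    (unscale (+ toℕ a - + toℕ b) (∣-resp (lemma (+ toℕ a) (+ toℕ b) (+ δ)) d)))
    where
    lemma : ∀ a b d → a * d - b * d ≡ (a - b) * d
    lemma = solve-∀

  leaves-rot : ∀ β → Rot β → ∀ i → leaves (β + i) ≡ leaves i
  leaves-rot β r i = cong (_∸ 2) (rot-periodic β r i)

  φ-cyc : RotatesBy (+ δ) φ
  φ-cyc = rotatesBy (+ δ) φ (proj₁ isφ)

  opaque
    unfolding cyc lf

    φ-lf : ∀ i j p p′ → to φ (lf i j p) ≡ lf (+ δ + i) j p′
    φ-lf i j p p′ =
      let a = idx (c L) i
          e = ∣⇒idx≡ (c L) (+ δ + + toℕ a) (+ δ + i)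
                (∣-resp (lemma (+ δ) (+ toℕ a) i) (idx≡⇒∣ (c L) (+ toℕ a) i (idx-toℕ (c L) a)))
          (k , k≡ , leaf≡) = transport e (fromℕ< p′)
      in trans (proj₂ isφ a (fromℕ< p) k
                 (trans (Fin.toℕ-fromℕ< p) (sym (trans k≡ (Fin.toℕ-fromℕ< p′))))) leaf≡
      where
      lemma : ∀ d a i → a - i ≡ (d + a) - (d + i)
      lemma = solve-∀
      transport : ∀ {b b′} → b′ ≡ b → (k : Fin (deg Up (x L b) ∸ 2)) →
                  Σ (Fin (deg Up (x L b′) ∸ 2)) λ k′ → toℕ k′ ≡ toℕ k × leaf L b′ k′ ≡ leaf L b k
      transport refl k = k , refl , refl

  rot-shift : ∀ k → Rot (shift k)
  rot-shift k = rot-* (+ δ) (rot-δ δ isδ) (+ k)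

  shift-suc : ∀ k i → + δ + (shift k + i) ≡ shift (suc k) + i
  shift-suc k i = lemma (+ k) (+ δ) i
    where
    lemma : ∀ k d i → d + (k * d + i) ≡ (1ℤ + k) * d + i
    lemma = solve-∀

  shift-zero : ∀ i → i ≡ shift 0 + i
  shift-zero i = lemma (+ δ) i
    where
    lemma : ∀ d i → i ≡ 0ℤ * d + i
    lemma = solve-∀

  ≡⇒≋ : ∀ {i j} → i ≡ j → i ≋ j
  ≡⇒≋ {i} refl = ∣-self i

  pow-cyc : ∀ k → RotatesBy (shift k) (pow φ k)
  pow-cyc zero    i = cong cyc (shift-zero i)
  pow-cyc (suc k) i = trans (cong (to φ) (pow-cyc k i)) (trans (φ-cyc (shift k + i)) (cong cyc (shift-suc k i)))

  pow-lf : ∀ k i j p p′ → to (pow φ k) (lf i j p) ≡ lf (shift k + i) j p′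
  pow-lf zero    i j p p′ = lf-cong i (shift 0 + i) p p′ (≡⇒≋ (shift-zero i)) refl
  pow-lf (suc k) i j p p′ = begin
    to φ (to (pow φ k) (lf i j p))  ≡⟨ cong (to φ) (pow-lf k i j p p₁) ⟩
    to φ (lf (shift k + i) j p₁)    ≡⟨ φ-lf (shift k + i) j p₁ p₂ ⟩
    lf (+ δ + (shift k + i)) j p₂   ≡⟨ lf-cong (+ δ + (shift k + i)) (shift (suc k) + i) p₂ p′ (≡⇒≋ (shift-suc k i)) refl ⟩
    lf (shift (suc k) + i) j p′     ∎
    where
    open ≡-Reasoning
    p₁ = subst (j <_) (sym (leaves-rot (shift k) (rot-shift k) i)) p
    p₂ = subst (j <_) (sym (leaves-rot (+ δ) (rot-δ δ isδ) (shift k + i))) p₁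

  -- `IsPhi` describes only where vertices go. Since leaf numbers are kept and leaf counts have
  -- period `δ`, each leaf at x_i has a partner at x_(δ+i), and adjacency follows.
  φ-aut : IsAut Up φ
  φ-aut = dihedral-aut φ (rotation-dihedral (+ δ)) φ-cyc
    (λ i j p → let p′ = subst (j <_) (sym (leaves-rot (+ δ) (rot-δ δ isδ) i)) p in j , p′ , φ-lf i j p p′)

  φ^ : Fin m → Perm N
  φ^ k = pow φ (toℕ k)

  φ^-aut : ∀ k → IsAut Up (φ^ k)
  φ^-aut k = pow-aut Up φ φ-aut (toℕ k)

  -- This stands in for φ^m = 1: exponents congruent modulo m give shifts congruent modulo c. The
  -- leaves agree too, because every power keeps leaf numbers.
  pow-cong : ∀ k k′ → shift k ≋ shift k′ → pow φ k ≈ₚ pow φ k′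
  pow-cong k k′ d u = go (position u)
    where
    lemma : ∀ a b i → a - b ≡ (a + i) - (b + i)
    lemma = solve-∀
    d+ : ∀ i → shift k + i ≋ shift k′ + i
    d+ i = ∣-resp (lemma (shift k) (shift k′) i) d
    go : ∀ {u} → Position u → to (pow φ k) u ≡ to (pow φ k′) u
    go (on-cycle i)    = trans (pow-cyc k i) (trans (cyc-cong (shift k + i) (shift k′ + i) (d+ i)) (sym (pow-cyc k′ i)))
    go (on-leaf i j p) =
      let p₁ = subst (j <_) (sym (leaves-rot (shift k) (rot-shift k) i)) p
          p₂ = subst (j <_) (sym (leaves-rot (shift k′) (rot-shift k′) i)) p
      in trans (pow-lf k i j p p₁)
        (trans (lf-cong (shift k + i) (shift k′ + i) p₁ p₂ (d+ i) refl) (sym (pow-lf k′ i j p p₂)))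

  φ^-+ : ∀ a b → φ^ (a +ₘ b) ≈ₚ (φ^ a ∘ₚ φ^ b)
  φ^-+ a b i = trans
    (pow-cong (toℕ (a +ₘ b)) (toℕ a ℕ.+ toℕ b)
      (∣-resp (lemma (+ toℕ (a +ₘ b)) (+ toℕ a + + toℕ b) (+ δ))
        (scale (+ toℕ (a +ₘ b) - (+ toℕ a + + toℕ b)) (+ₘ-congruent a b))) i)
    (pow-+ φ (toℕ a) (toℕ b) i)
    where
    lemma : ∀ p q d → (p - q) * d ≡ p * d - q * d
    lemma = solve-∀

  from-pow : ∀ k i → from (pow φ k) (cyc i) ≡ cyc (i - shift k)
  from-pow k i = from-of (pow φ k) (trans (pow-cyc k (i - shift k)) (cong cyc (lemma (shift k) i)))
    where
    lemma : ∀ s i → s + (i - s) ≡ i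
    lemma = solve-∀

  0<leaves-shift : ∀ k → 0 < leaves (shift k + 0ℤ)
  0<leaves-shift k = subst (0 <_) (sym (leaves-rot (shift k) (rot-shift k) 0ℤ)) 0<leaves

  pow-w : ∀ k → to (pow φ k) w ≡ lf (shift k + 0ℤ) 0 (0<leaves-shift k)
  pow-w k = trans (cong (to (pow φ k)) w≡lf) (pow-lf k 0ℤ 0 0<leaves (0<leaves-shift k))

  φ^-separated : ∀ {a b} → a ≢ b → Separated (φ^ a) (φ^ b)
  φ^-separated {a} {b} a≢b =
      (λ e → a≢b (shift-inj a b (∣-resp (lemma₁ (ν L) (shift (toℕ a)) (shift (toℕ b)))
        (cyc-inj (ν L - shift (toℕ b)) (ν L - shift (toℕ a))
          (trans (sym (from-pow (toℕ b) (ν L))) (trans (sym (subst (λ u → from (φ^ a) u ≡ from (φ^ b) u) v≡cyc e)) (from-pow (toℕ a) (ν L))))))))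
    , (λ e → a≢b (shift-inj a b (∣-resp (lemma₂ (shift (toℕ a)) (shift (toℕ b)))
        (proj₁ (lf-inj (shift (toℕ a) + 0ℤ) (shift (toℕ b) + 0ℤ) (0<leaves-shift (toℕ a)) (0<leaves-shift (toℕ b))
          (trans (sym (pow-w (toℕ a))) (trans e (pow-w (toℕ b)))))))))
    where
    lemma₁ : ∀ n a b → (n - b) - (n - a) ≡ a - b
    lemma₁ = solve-∀
    lemma₂ : ∀ a b → (a + 0ℤ) - (b + 0ℤ) ≡ a - b
    lemma₂ = solve-∀

  0ᵐ : Fin m
  0ᵐ = fromℕ< (ℕ.>-nonZero⁻¹ m)

  φ^0 : φ^ 0ᵐ ≈ₚ idPerm
  φ^0 i = cong (λ k → to (pow φ k) i) (Fin.toℕ-fromℕ< (ℕ.>-nonZero⁻¹ m))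

  opaque
    cyc-as-from : ∀ β → + δ ∣ β → Σ (Fin m) λ k → cyc (β + ν L) ≡ from (φ^ k) v
    cyc-as-from β d =
      let (k , s) = residue (- β) (∣m⇒∣-m d) in
      k , trans (cyc-cong (β + ν L) (ν L - shift (toℕ k)) (∣-resp (lemma (shift (toℕ k)) β (ν L)) s))
                (trans (sym (from-pow (toℕ k) (ν L))) (cong (from (φ^ k)) (sym v≡cyc)))
      where
      lemma : ∀ s β n → s - (- β) ≡ (β + n) - (n - s)
      lemma = solve-∀

    cyc-as-pow : ∀ β i → + δ ∣ β → Σ (Fin m) λ k → cyc (β + i) ≡ to (φ^ k) (cyc i)
    cyc-as-pow β i d =
      let (k , s) = residue β d in
      k , trans (cyc-cong (β + i) (shift (toℕ k) + i) (∣-resp (lemma (shift (toℕ k)) β i) (∣-swap (shift (toℕ k)) β s)))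
                (sym (pow-cyc (toℕ k) i))
      where
      lemma : ∀ s β i → β - s ≡ (β + i) - (s + i)
      lemma = solve-∀

  rotates⇒δ∣ : ∀ β l → IsAut Up l → RotatesBy β l → + δ ∣ β
  rotates⇒δ∣ β l la lr = δ∣rot δ isδ β (l , la , lr)

  from-v : ∀ l {u} → to (invₚ l) (cyc (ν L)) ≡ u → from l v ≡ u
  from-v l = trans (cong (from l) v≡cyc)

  -- Cases (i) and (ii): the cyclic group

  InOrbit : Fin N → Perm N → Set
  InOrbit u l = Σ ℕ λ k → k < m × to l u ≡ to (pow φ k) u

  CaseI CaseII : Set
  CaseI  = ∀ l → IsAut Up l → IsReflection L l → InOrbit (X L (ν L)) l
  CaseII = deg Up (X L 0ℤ) ≡ 3 × (∀ l → IsAut Up l → IsReflection L l → InOrbit (X L 0ℤ) l)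

  opaque
    unfolding cyc

    orbit-cyc : ∀ i → (∀ l → IsAut Up l → IsReflection L l → InOrbit (X L i) l) →
                ∀ β l → IsAut Up l → ReflectsBy β l → InOrbit (cyc i) l
    orbit-cyc i h β l la ref = h l la (β , ref)

  -- The hypothesis concerns images of x_ν and the goal concerns the preimage of v, so the argument
  -- is applied to the inverse of `l`, again an automorphism.
  caseI-hits : CaseI → ∀ l → IsAut Up l → Σ (Fin m) λ k → from l v ≡ from (φ^ k) v
  caseI-hits caseI l la = [ rotated , reflected ]′ (aut-classify (invₚ l) la′)
    where
    la′ = inv-aut Up l la
    Goal = Σ (Fin m) λ k → from l v ≡ from (φ^ k) v

    rotated : (∃ λ β → RotatesBy β (invₚ l)) → Goal
    rotated (β , rot) =
      let (k , e) = cyc-as-from β (rotates⇒δ∣ β (invₚ l) la′ rot) in k , from-v l (trans (rot (ν L)) e)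

    reflected′ : InOrbit (cyc (ν L)) (invₚ l) → Goal
    reflected′ (k , _ , e) =
      -- A forward image under φ^k is a preimage under φ^k′ with k′ ≡ -k modulo m.
      let (k′ , e′) = cyc-as-from (shift k) (divides (+ k) refl)
      in k′ , from-v l (trans e (trans (pow-cyc k (ν L)) e′))

    reflected : (∃ λ β → ReflectsBy β (invₚ l)) → Goal
    reflected (β , ref) = reflected′ (orbit-cyc (ν L) caseI β (invₚ l) la′ ref)

  -- With d(x_0) = 3 each vertex of Φ(x_0) carries exactly one leaf. Thus `to l w` is the leaf at
  -- the image of x_0, and it suffices to place that image in Φ(x_0).
  caseII-hits : CaseII → ∀ l → IsAut Up l → Σ (Fin m) λ k → to l w ≡ to (φ^ k) w
  caseII-hits (deg≡3 , caseII) l la =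
    let (k , e) = x₀-image in k , w-image k e refl (position (to l w))
    where
    X₀Image = Σ (Fin m) λ k → to l (cyc 0ℤ) ≡ to (φ^ k) (cyc 0ℤ)

    rotated : (∃ λ β → RotatesBy β l) → X₀Image
    rotated (β , rot) = let (k , e) = cyc-as-pow β 0ℤ (rotates⇒δ∣ β l la rot) in k , trans (rot 0ℤ) e

    reflected : (∃ λ β → ReflectsBy β l) → X₀Image
    reflected (β , ref) =
      let (k , k<m , e) = orbit-cyc 0ℤ caseII β l la ref in
      fromℕ< k<m , trans e (cong (λ n → to (pow φ n) (cyc 0ℤ)) (sym (Fin.toℕ-fromℕ< k<m)))

    x₀-image : X₀Image
    x₀-image = [ rotated , reflected ]′ (aut-classify l la)

    w-image : ∀ k → to l (cyc 0ℤ) ≡ to (φ^ k) (cyc 0ℤ) → ∀ {b} → to l w ≡ b → Position b → to l w ≡ to (φ^ k) w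
    w-image k e e′ (on-cycle i) = contradiction e′ (deg1≢cyc i (trans (deg-aut Up l la w) w-deg))
    w-image k e e′ (on-leaf i j p) = trans e′ (trans
      (lf-cong i (shift (toℕ k) + 0ℤ) p (0<leaves-shift (toℕ k))
        (∣-swap (shift (toℕ k) + 0ℤ) i (cyc-inj (shift (toℕ k) + 0ℤ) i at-i)) j≡0)
      (sym (pow-w (toℕ k))))
      where
      at-i : cyc (shift (toℕ k) + 0ℤ) ≡ cyc i
      at-i = trans (sym (pow-cyc (toℕ k) 0ℤ)) (trans (sym e) (lf-neighbour i j p
        (trans (cong (adj Up (to l (cyc 0ℤ))) (sym e′)) (trans (la (cyc 0ℤ) w) cyc-w-adj))))
      one-leaf : leaves i ≡ 1
      one-leaf = trans (cong (λ u → deg Up u ∸ 2) (sym at-i))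
        (trans (leaves-rot (shift (toℕ k)) (rot-shift (toℕ k)) 0ℤ)
               (trans (cong (λ u → deg Up u ∸ 2) (cyc≡X 0ℤ)) (cong (_∸ 2) deg≡3)))
      j≡0 : j ≡ 0
      j≡0 = ℕ.n<1⇒n≡0 (subst (j <_) one-leaf p)

  module _ (nontrivial : NontrivialRotation L) where

    bu-aut : ∀ l → isBU Up w v l ≡ true → InB Up w v l → IsAut Up l
    bu-aut l bu _ =
      let (μ , μa , (β , rot) , moves) = nontrivial in
      bu⇒aut β (rotation-periodic β μ μa (rotatesBy β μ rot))
        (λ d → moves (trans (rot 0ℤ) (trans (sym (cyc≡X (β + 0ℤ))) (trans (cong cyc (ℤ.+-identityʳ β)) (trans (cyc-cong β 0ℤ d) (cyc≡X 0ℤ))))))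
        l bu

    cyclic : (CaseI ⊎ CaseII) →
      Σ (List (Perm N)) λ Xs → Optimum Up w v Xs × InterAutEq Up Xs (InΦ φ m) × IsCyclicGroup (InΦ φ m) m
    cyclic cases =
      let (Xs , opt , only , has) = optimum-extending aut-w≢v bu-aut φ^ φ^-aut φ^-separated (0ᵐ , φ^0)
                                      ([ inj₁ ∘ caseI-hits , inj₂ ∘ caseII-hits ]′ cases)
      in Xs , opt
       , ( (λ l l∈ la → let (k , e) = only l l∈ la in toℕ k , Fin.toℕ<n k , e)
         , (λ l (k , k<m , e) →
              aut-resp Up {pow φ k} {l} (λ i → sym (e i)) (pow-aut Up φ φ-aut k)
            , let (μ , μ∈ , e′) = has (fromℕ< k<m) in μ , μ∈ , λ i →
                trans (e′ i) (trans (cong (λ n → to (pow φ n) i) (Fin.toℕ-fromℕ< k<m)) (sym (e i)))))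
       , φ^ , (λ a → toℕ a , Fin.toℕ<n a , λ _ → refl)
       , (λ l (k , k<m , e) → fromℕ< k<m , λ i → trans (e i) (cong (λ n → to (pow φ n) i) (sym (Fin.toℕ-fromℕ< k<m))))
       -- Equal powers send w to the same leaf, which separation forbids for distinct exponents.
       , (λ a b e → decidable-stable (a Fin.≟ b) (λ a≢b → proj₂ (φ^-separated a≢b) (e w)))
       , φ^-+

  opaque
    unfolding cyc

    orbit-X : ∀ i → (∀ β l → IsAut Up l → ReflectsBy β l → InOrbit (cyc i) l) →
              ∀ l → IsAut Up l → IsReflection L l → InOrbit (X L i) l
    orbit-X i h l la (β , ref) = h β l la ref

    isReflection : ∀ α l → ReflectsBy α l → IsReflection L l
    isReflection α l ref = α , ref

    deg-cyc0 : ∀ {d} → deg Up (cyc 0ℤ) ≡ d → deg Up (X L 0ℤ) ≡ d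
    deg-cyc0 e = e

  -- Finding a reflection outside case (i)

  ≋-representative : ∀ i → i ≋ + toℕ (idx (c L) i)
  ≋-representative i = idx≡⇒∣ (c L) i (+ toℕ (idx (c L) i)) (sym (idx-toℕ (c L) (idx (c L) i)))

  mirror-resp : ∀ α β → α ≋ β → Mirror α → Mirror β
  mirror-resp α β d h i = trans
    (cong (deg Up) (cyc-cong (β - i) (α - i) (∣-resp (lemma α β i) (∣-swap α β d)))) (h i)
    where
    lemma : ∀ α β i → β - α ≡ (β - i) - (α - i)
    lemma = solve-∀

  mirror? : ∀ α → Dec (Mirror α)
  mirror? α = map′ everywhere (λ h r → h (+ toℕ r))
    (Fin.all? {n = c L} (λ r → deg Up (cyc (α - + toℕ r)) ℕ.≟ deg Up (cyc (+ toℕ r))))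
    where
    lemma : ∀ α r i → r - i ≡ (α - i) - (α - r)
    lemma = solve-∀
    everywhere : (∀ (r : Fin (c L)) → deg Up (cyc (α - + toℕ r)) ≡ deg Up (cyc (+ toℕ r))) → Mirror α
    everywhere h i = trans (cong (deg Up) (cyc-cong (α - i) (α - s) (∣-resp (lemma α s i) s≋i)))
                     (trans (h (idx (c L) i)) (cong (deg Up) (cyc-cong s i s≋i)))
      where
      s = + toℕ (idx (c L) i)
      s≋i = ∣-swap i s (≋-representative i)

  -- A reflection with parameter `α` sends x_ν to x_(α-ν), which lies in Φ(x_ν) when δ divides α-2ν.
  -- Both the mirror condition and this divisibility depend only on α modulo c, so all residues can
  -- be tested. If no residue qualifies, every reflection keeps x_ν in its orbit, which is case (i).
  off-orbit-mirror : ¬ CaseI → Σ ℤ λ α → Mirror α × ¬ (+ δ ∣ α - ν L - ν L)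
  off-orbit-mirror ¬caseI
    with Fin.any? {n = c L} (λ a → mirror? (+ toℕ a) ×-dec ¬? (+ δ ∣? (+ toℕ a - ν L - ν L)))
  ... | yes (a , good) = + toℕ a , good
  ... | no none = contradiction (orbit-X (ν L) caseI) ¬caseI
    where
    lemma₁ : ∀ β a n → (β - a) + (a - n - n) ≡ β - n - n
    lemma₁ = solve-∀
    lemma₂ : ∀ β n → β - n ≡ (β - n - n) + n
    lemma₂ = solve-∀
    caseI : ∀ β l → IsAut Up l → ReflectsBy β l → InOrbit (cyc (ν L)) l
    caseI β l la ref =
      let a = idx (c L) β
          β≋a = ≋-representative β
          δ∣a = decidable-stable (+ δ ∣? (+ toℕ a - ν L - ν L))
                  (λ n → none (a , mirror-resp β (+ toℕ a) β≋a (reflection-mirror β l la ref) , n))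
          (k , e) = cyc-as-pow (β - ν L - ν L) (ν L)
                      (∣-resp (lemma₁ β (+ toℕ a) (ν L)) (∣m∣n⇒∣m+n (≋⇒δ∣ {β} {+ toℕ a} β≋a) δ∣a))
      in toℕ k , Fin.toℕ<n k , trans (ref (ν L)) (trans (cong cyc (lemma₂ β (ν L))) e)

  reversed< : ∀ {j n} → j < n → n ∸ suc j < n
  reversed< {j} {suc n} _ = s≤s (ℕ.m∸n≤m n j)

  reversed-involutive : ∀ {j n} → j < n → n ∸ suc (n ∸ suc j) ≡ j
  reversed-involutive {j} {suc n} (s≤s j≤n) = ℕ.m∸[m∸n]≡n j≤n

  -- The reflection that reverses leaf orders, and the dihedral group

  module Reflect (α : ℤ) (mirror : Mirror α) where

    leaves-mirror : ∀ i → leaves (α - i) ≡ leaves i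
    leaves-mirror i = cong (_∸ 2) (mirror i)

    leaf< : ∀ i j → j < leaves i → leaves i ∸ suc j < leaves (α - i)
    leaf< i j p = subst (leaves i ∸ suc j <_) (sym (leaves-mirror i)) (reversed< p)

    reflect : ∀ {u} → Position u → Fin N
    reflect (on-cycle i)    = cyc (α - i)
    -- Reversing the leaves moves w off Φ(w) whenever x₀ carries at least two leaves.
    reflect (on-leaf i j p) = lf (α - i) (leaves i ∸ suc j) (leaf< i j p)

    α-cong : ∀ k i → k ≋ i → α - k ≋ α - i
    α-cong = Dihedral.preserves (reflection-dihedral α)

    -- Together with `reflect-lf` this shows that the value does not depend on the representative
    -- index that `position` happens to choose.
    reflect-cyc : ∀ {u} (P : Position u) i → u ≡ cyc i → reflect P ≡ cyc (α - i)
    reflect-cyc (on-cycle k)    i e = cyc-cong (α - k) (α - i) (α-cong k i (cyc-inj k i e))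
    reflect-cyc (on-leaf k j p) i e = contradiction e (lf≢cyc k j p i)

    reflect-lf : ∀ {u} (P : Position u) i j p p′ → u ≡ lf i j p → reflect P ≡ lf (α - i) (leaves i ∸ suc j) p′
    reflect-lf (on-cycle k)      i j p p′ e = contradiction (sym e) (lf≢cyc i j p k)
    reflect-lf (on-leaf k j₁ p₁) i j p p′ e =
      let (d , j₁≡j) = lf-inj k i p₁ p e in
      lf-cong (α - k) (α - i) (leaf< k j₁ p₁) p′ (α-cong k i d)
        (cong₂ (λ n j → n ∸ suc j) (cong (λ u → deg Up u ∸ 2) (cyc-cong k i d)) j₁≡j)

    π₀ : Fin N → Fin N
    π₀ u = reflect (position u)

    π₀-cyc : ∀ i → π₀ (cyc i) ≡ cyc (α - i)
    π₀-cyc i = reflect-cyc (position (cyc i)) i refl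

    π₀-lf : ∀ i j p p′ → π₀ (lf i j p) ≡ lf (α - i) (leaves i ∸ suc j) p′
    π₀-lf i j p p′ = reflect-lf (position (lf i j p)) i j p p′ refl

    cancel : ∀ α i → α - (α - i) ≡ i
    cancel = solve-∀

    π₀-involutive : ∀ u → π₀ (π₀ u) ≡ u
    π₀-involutive u = go (position u)
      where
      go : ∀ {u} → Position u → π₀ (π₀ u) ≡ u
      go (on-cycle i) = trans (cong π₀ (π₀-cyc i)) (trans (π₀-cyc (α - i)) (cong cyc (cancel α i)))
      go (on-leaf i j p) =
        let p₁ = leaf< i j p
            p₂ = leaf< (α - i) (leaves i ∸ suc j) p₁
        in trans (cong π₀ (π₀-lf i j p p₁)) (trans (π₀-lf (α - i) (leaves i ∸ suc j) p₁ p₂)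
             (lf-cong (α - (α - i)) i p₂ p (≡⇒≋ (cancel α i))
               (trans (cong (_∸ suc (leaves i ∸ suc j)) (leaves-mirror i)) (reversed-involutive p))))

    π : Perm N
    π = record { to = π₀ ; from = π₀ ; from-to = π₀-involutive ; to-from = π₀-involutive }

    π-aut : IsAut Up π
    π-aut = dihedral-aut π (reflection-dihedral α) π₀-cyc
      (λ i j p → leaves i ∸ suc j , leaf< i j p , π₀-lf i j p (leaf< i j p))

    -- On the cycle this is the usual relation between a rotation and a reflection. It extends to
    -- the leaves because powers of φ keep leaf numbers and leaf counts, so they commute with the
    -- reversal.
    π-conjugates : ∀ b → (π ∘ₚ φ^ b) ≈ₚ (φ^ (-ₘ b) ∘ₚ π)
    π-conjugates b u = go (position u)
      where
      s = shift (toℕ b)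
      t = shift (toℕ (-ₘ b))
      lemma₁ : ∀ b′ b d → (b′ - - b) * d ≡ b′ * d - - (b * d)
      lemma₁ = solve-∀
      t≋-s : t ≋ - s
      t≋-s = ∣-resp (lemma₁ (+ toℕ (-ₘ b)) (+ toℕ b) (+ δ)) (scale (+ toℕ (-ₘ b) - - + toℕ b) (-ₘ-congruent b))
      lemma₂ : ∀ t s α i → - (t - - s) ≡ (α - (s + i)) - (t + (α - i))
      lemma₂ = solve-∀
      indices : ∀ i → α - (s + i) ≋ t + (α - i)
      indices i = ∣-resp (lemma₂ t s α i) (∣m⇒∣-m t≋-s)
      go : ∀ {u} → Position u → to (π ∘ₚ φ^ b) u ≡ to (φ^ (-ₘ b) ∘ₚ π) u
      go (on-cycle i) = begin
        π₀ (to (φ^ b) (cyc i))        ≡⟨ cong π₀ (pow-cyc (toℕ b) i) ⟩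
        π₀ (cyc (s + i))              ≡⟨ π₀-cyc (s + i) ⟩
        cyc (α - (s + i))             ≡⟨ cyc-cong (α - (s + i)) (t + (α - i)) (indices i) ⟩
        cyc (t + (α - i))             ≡⟨ pow-cyc (toℕ (-ₘ b)) (α - i) ⟨
        to (φ^ (-ₘ b)) (cyc (α - i))  ≡⟨ cong (to (φ^ (-ₘ b))) (π₀-cyc i) ⟨
        to (φ^ (-ₘ b)) (π₀ (cyc i))   ∎
        where open ≡-Reasoning
      go (on-leaf i j p) = begin
        π₀ (to (φ^ b) (lf i j p))        ≡⟨ cong π₀ (pow-lf (toℕ b) i j p p₁) ⟩
        π₀ (lf (s + i) j p₁)             ≡⟨ π₀-lf (s + i) j p₁ p₂ ⟩
        lf (α - (s + i)) (leaves (s + i) ∸ suc j) p₂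
          ≡⟨ lf-cong (α - (s + i)) (t + (α - i)) p₂ p₄ (indices i)
               (cong (_∸ suc j) (leaves-rot s (rot-shift (toℕ b)) i)) ⟩
        lf (t + (α - i)) (leaves i ∸ suc j) p₄        ≡⟨ pow-lf (toℕ (-ₘ b)) (α - i) (leaves i ∸ suc j) p₃ p₄ ⟨
        to (φ^ (-ₘ b)) (lf (α - i) (leaves i ∸ suc j) p₃)  ≡⟨ cong (to (φ^ (-ₘ b))) (π₀-lf i j p p₃) ⟨
        to (φ^ (-ₘ b)) (π₀ (lf i j p))   ∎
        where
        open ≡-Reasoning
        p₁ = subst (j <_) (sym (leaves-rot s (rot-shift (toℕ b)) i)) p
        p₂ = leaf< (s + i) j p₁
        p₃ = leaf< i j p
        p₄ = subst (leaves i ∸ suc j <_) (sym (leaves-rot t (rot-shift (toℕ (-ₘ b))) (α - i))) p₃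

    π^ : Bool → Perm N
    π^ e = if e then π else idPerm

    elem : Fin m × Bool → Perm N
    elem (a , e) = φ^ a ∘ₚ π^ e

    elem-aut : ∀ g → IsAut Up (elem g)
    elem-aut (a , false) = φ^-aut a
    elem-aut (a , true)  = ∘-aut Up (φ^ a) π (φ^-aut a) π-aut

    elem-mul : ∀ g h → elem (dihMul g h) ≈ₚ (elem g ∘ₚ elem h)
    elem-mul (a , false) (b , e) i = φ^-+ a b (to (π^ e) i)
    elem-mul (a , true) (b , e) i = begin
      to (φ^ (a +ₘ (-ₘ b))) (to (π^ (not e)) i)         ≡⟨ φ^-+ a (-ₘ b) (to (π^ (not e)) i) ⟩
      to (φ^ a) (to (φ^ (-ₘ b)) (to (π^ (not e)) i))    ≡⟨ cong (to (φ^ a) ∘ to (φ^ (-ₘ b))) (π-absorb e) ⟨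
      to (φ^ a) (to (φ^ (-ₘ b)) (π₀ (to (π^ e) i)))     ≡⟨ cong (to (φ^ a)) (π-conjugates b (to (π^ e) i)) ⟨
      to (φ^ a) (π₀ (to (φ^ b) (to (π^ e) i)))          ∎
      where
      open ≡-Reasoning
      π-absorb : ∀ e → π₀ (to (π^ e) i) ≡ to (π^ (not e)) i
      π-absorb false = refl
      π-absorb true  = π₀-involutive i

    module _ (off : ¬ (+ δ ∣ α - ν L - ν L)) (¬caseII : ¬ CaseII) where

      from-elem : ∀ a → from (elem (a , true)) v ≡ cyc (α - (ν L - shift (toℕ a)))
      from-elem a = trans (cong (π₀ ∘ from (φ^ a)) v≡cyc)
        (trans (cong π₀ (from-pow (toℕ a) (ν L))) (π₀-cyc (ν L - shift (toℕ a))))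

      from-φ^ : ∀ a → from (φ^ a) v ≡ cyc (ν L - shift (toℕ a))
      from-φ^ a = trans (cong (from (φ^ a)) v≡cyc) (from-pow (toℕ a) (ν L))

      last< : leaves 0ℤ ∸ 1 < leaves (α - 0ℤ)
      last< = leaf< 0ℤ 0 0<leaves

      last-shift< : ∀ (a : Fin m) → leaves 0ℤ ∸ 1 < leaves (shift (toℕ a) + (α - 0ℤ))
      last-shift< a = subst (leaves 0ℤ ∸ 1 <_) (sym (leaves-rot (shift (toℕ a)) (rot-shift (toℕ a)) (α - 0ℤ))) last<

      elem-w : ∀ a → to (elem (a , true)) w ≡ lf (shift (toℕ a) + (α - 0ℤ)) (leaves 0ℤ ∸ 1) (last-shift< a)
      elem-w a = trans (cong (to (φ^ a) ∘ π₀) w≡lf) (trans (cong (to (φ^ a)) (π₀-lf 0ℤ 0 0<leaves last<))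
                   (pow-lf (toℕ a) (α - 0ℤ) (leaves 0ℤ ∸ 1) last< (last-shift< a)))

      δ∣shift : ∀ k → + δ ∣ shift k
      δ∣shift k = divides (+ k) refl

      -- A coincidence at v would make δ divide α-2ν, against `off`. A coincidence at w would make
      -- the last leaf at x_0 also the first, so d(x_0) = 3, and would make δ divide α. All
      -- reflections have parameters congruent to α modulo δ, so each would keep x_0 in Φ(x_0): case
      -- (ii).
      rotations-off-reflections : ∀ a b → Separated (elem (a , false)) (elem (b , true))
      rotations-off-reflections a b =
          (λ e → off (∣-resp (lemma₁ α (ν L) (shift (toℕ a)) (shift (toℕ b)))
            (∣m∣n⇒∣m-n (∣m∣n⇒∣m-n
              (≋⇒δ∣ {α - (ν L - shift (toℕ b))} {ν L - shift (toℕ a)}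
                (cyc-inj (α - (ν L - shift (toℕ b))) (ν L - shift (toℕ a))
                  (trans (sym (from-elem b)) (trans (sym e) (from-φ^ a)))))
              (δ∣shift (toℕ a))) (δ∣shift (toℕ b)))))
        , (λ e → w-hit (lf-inj (shift (toℕ b) + (α - 0ℤ)) (shift (toℕ a) + 0ℤ) (last-shift< b) (0<leaves-shift (toℕ a))
                   (trans (sym (elem-w b)) (trans (sym e) (pow-w (toℕ a))))))
        where
        lemma₁ : ∀ α n a b → ((α - (n - b)) - (n - a)) - a - b ≡ α - n - n
        lemma₁ = solve-∀
        lemma₂ : ∀ α a b → ((b + (α - 0ℤ)) - (a + 0ℤ)) - (b - a) ≡ α
        lemma₂ = solve-∀
        lemma₃ : ∀ β α → (β - α) + α ≡ β
        lemma₃ = solve-∀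
        lemma₄ : ∀ β → β - 0ℤ ≡ β + 0ℤ
        lemma₄ = solve-∀
        -- The positivity premise excludes d ≤ 2, where truncated subtraction also gives 0.
        deg3 : ∀ {d} → 0 < d ∸ 2 → d ∸ 2 ∸ 1 ≡ 0 → d ≡ 3
        deg3 {suc (suc (suc zero))} _ _ = refl
        w-hit : (shift (toℕ b) + (α - 0ℤ) ≋ shift (toℕ a) + 0ℤ) × leaves 0ℤ ∸ 1 ≡ 0 → ⊥
        w-hit (d , one-leaf) = ¬caseII (deg-cyc0 (deg3 0<leaves one-leaf) , orbit-X 0ℤ orbit)
          where
          δ∣α : + δ ∣ α
          δ∣α = ∣-resp (lemma₂ α (shift (toℕ a)) (shift (toℕ b)))
            (∣m∣n⇒∣m-n (≋⇒δ∣ {shift (toℕ b) + (α - 0ℤ)} {shift (toℕ a) + 0ℤ} d)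
              (∣m∣n⇒∣m-n (δ∣shift (toℕ b)) (δ∣shift (toℕ a))))
          orbit : ∀ β l → IsAut Up l → ReflectsBy β l → InOrbit (cyc 0ℤ) l
          orbit β l la ref =
            let δ∣β = ∣-resp (lemma₃ β α) (∣m∣n⇒∣m+n
                        (δ∣rot δ isδ (β - α) (reflections-compose β α l π la π-aut ref π₀-cyc)) δ∣α)
                (k , e) = cyc-as-pow β 0ℤ δ∣β
            in toℕ k , Fin.toℕ<n k , trans (ref 0ℤ) (trans (cong cyc (lemma₄ β)) e)

      elem-separated : ∀ {g h} → g ≢ h → Separated (elem g) (elem h)
      elem-separated {a , false} {b , false} g≢h = φ^-separated (λ a≡b → g≢h (cong (_, false) a≡b))
      elem-separated {a , false} {b , true}  g≢h = rotations-off-reflections a b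
      elem-separated {a , true}  {b , false} g≢h =
        separated-sym {elem (b , false)} {elem (a , true)} (rotations-off-reflections b a)
      elem-separated {a , true}  {b , true}  g≢h =
          (λ e → proj₁ a-b (to-injective π e))
        , (λ e → a≢b (shift-inj a b (∣-resp (lemma (shift (toℕ a)) (shift (toℕ b)) (α - 0ℤ))
            (proj₁ (lf-inj (shift (toℕ a) + (α - 0ℤ)) (shift (toℕ b) + (α - 0ℤ)) (last-shift< a) (last-shift< b)
              (trans (sym (elem-w a)) (trans e (elem-w b))))))))
        where
        a≢b : a ≢ b
        a≢b a≡b = g≢h (cong (_, true) a≡b)
        a-b = φ^-separated a≢b
        lemma : ∀ a b α → (a + α) - (b + α) ≡ a - b
        lemma = solve-∀

      -- The inverse of `l` is a rotation by a multiple of δ or a reflection whose parameter differs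
      -- from `α` by such a multiple. Only the preimage of v is usable here: an automorphism may
      -- send w to a leaf that is neither first nor last.
      elem-hits : ∀ l → IsAut Up l → Σ (Fin m × Bool) λ g → from l v ≡ from (elem g) v
      elem-hits l la = [ rotated , reflected ]′ (aut-classify (invₚ l) la′)
        where
        la′ = inv-aut Up l la
        Goal = Σ (Fin m × Bool) λ g → from l v ≡ from (elem g) v

        rotated : (∃ λ β → RotatesBy β (invₚ l)) → Goal
        rotated (β , rot) =
          let (k , e) = cyc-as-from β (rotates⇒δ∣ β (invₚ l) la′ rot) in (k , false) , from-v l (trans (rot (ν L)) e)

        lemma : ∀ s β α n → s - (β - α) ≡ (α - (n - s)) - (β - n)
        lemma = solve-∀

        reflected : (∃ λ β → ReflectsBy β (invₚ l)) → Goal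
        reflected (β , ref) =
          let (k , s) = residue (β - α) (δ∣rot δ isδ (β - α) (reflections-compose β α (invₚ l) π la′ π-aut ref π₀-cyc))
              t = α - (ν L - shift (toℕ k))
          in (k , true) , from-v l (trans (ref (ν L)) (trans
               (cyc-cong (β - ν L) t (∣-swap t (β - ν L) (∣-resp (lemma (shift (toℕ k)) β α (ν L)) s)))
               (sym (from-elem k))))

      -- A numbering of the group elements by 2m indices, the form in which `optimum-extending`
      -- counts.
      split : Fin (m ℕ.+ m) → Fin m × Bool
      split k = [ _, false , _, true ]′ (Fin.splitAt m k)

      unsplit : Fin m × Bool → Fin (m ℕ.+ m)
      unsplit (a , false) = Fin.join m m (inj₁ a)
      unsplit (a , true)  = Fin.join m m (inj₂ a)

      split-unsplit : ∀ g → split (unsplit g) ≡ g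
      split-unsplit (a , false) = cong [ _, false , _, true ]′ (Fin.splitAt-join m m (inj₁ a))
      split-unsplit (a , true)  = cong [ _, false , _, true ]′ (Fin.splitAt-join m m (inj₂ a))

      unsplit-split : ∀ k → unsplit (split k) ≡ k
      unsplit-split k = trans (go (Fin.splitAt m k)) (Fin.join-splitAt m m k)
        where
        go : ∀ s → unsplit ([ _, false , _, true ]′ s) ≡ Fin.join m m s
        go (inj₁ a) = refl
        go (inj₂ a) = refl

      split-injective : ∀ {k k′} → split k ≡ split k′ → k ≡ k′
      split-injective {k} {k′} e = trans (sym (unsplit-split k)) (trans (cong unsplit e) (unsplit-split k′))

      dihedral : NontrivialRotation L →
        Σ (Perm N) λ π → IsAut Up π × IsReflection L π × Σ (List (Perm N)) λ Xs →
          Optimum Up w v Xs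
        × InterAutEq Up Xs (λ l → InΦ φ m l ⊎ InΦπ φ m π l)
        × IsDihedralGroup (λ l → InΦ φ m l ⊎ InΦπ φ m π l) m
      dihedral nontrivial = π , π-aut , isReflection α π π₀-cyc , Xs , opt , (inside , outside)
        , elem , elem-member
        , (λ l s → let (g , e) = member-elem l s in g , e)
        , (λ g h e → decidable-stable (g ≟ h) (λ g≢h → proj₂ (elem-separated g≢h) (e w)))
        , elem-mul
        where
        _≟_ = Product.≡-dec Fin._≟_ Bool._≟_

        Member : Perm N → Set
        Member l = InΦ φ m l ⊎ InΦπ φ m π l

        elem-member : ∀ g → Member (elem g)
        elem-member (a , false) = inj₁ (toℕ a , Fin.toℕ<n a , λ _ → refl)
        elem-member (a , true)  = inj₂ (toℕ a , Fin.toℕ<n a , λ _ → refl)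

        member-resp : ∀ {l l′} → l ≈ₚ l′ → Member l′ → Member l
        member-resp e (inj₁ (k , k<m , e′)) = inj₁ (k , k<m , λ i → trans (e i) (e′ i))
        member-resp e (inj₂ (k , k<m , e′)) = inj₂ (k , k<m , λ i → trans (e i) (e′ i))

        member-elem : ∀ l → Member l → Σ (Fin m × Bool) λ g → l ≈ₚ elem g
        member-elem l (inj₁ (k , k<m , e)) = (fromℕ< k<m , false) , λ i →
          trans (e i) (cong (λ n → to (pow φ n) i) (sym (Fin.toℕ-fromℕ< k<m)))
        member-elem l (inj₂ (k , k<m , e)) = (fromℕ< k<m , true) , λ i →
          trans (e i) (cong (λ n → to (pow φ n) (π₀ i)) (sym (Fin.toℕ-fromℕ< k<m)))

        optimum = optimum-extending aut-w≢v (bu-aut nontrivial) (elem ∘ split) (elem-aut ∘ split)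
          (λ k≢k′ → elem-separated (k≢k′ ∘ split-injective))
          (unsplit (0ᵐ , false) , λ i → trans (cong (λ g → to (elem g) i) (split-unsplit (0ᵐ , false))) (φ^0 i))
          (inj₁ (λ l la → let (g , e) = elem-hits l la in
            unsplit g , trans e (cong (λ g → from (elem g) v) (sym (split-unsplit g)))))
        Xs = proj₁ optimum
        opt = proj₁ (proj₂ optimum)

        inside : ∀ l → l ∈ Xs → IsAut Up l → Member l
        inside l l∈ la =
          let (k , e) = proj₁ (proj₂ (proj₂ optimum)) l l∈ la in
          member-resp {l} {elem (split k)} e (elem-member (split k))

        outside : ∀ l → Member l → IsAut Up l × Σ (Perm N) λ μ → μ ∈ Xs × μ ≈ₚ l
        outside l s =
          let (g , e) = member-elem l s
              (μ , μ∈ , e′) = proj₂ (proj₂ (proj₂ optimum)) (unsplit g)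
          in aut-resp Up {elem g} {l} (λ i → sym (e i)) (elem-aut g)
           , μ , μ∈ , λ i → trans (e′ i) (trans (cong (λ g → to (elem g) i) (split-unsplit g)) (sym (e i)))

theorem5p8 :
  (n : ℕ) (U T : Graph (suc n)) →
  Sunshine U → Caterpillar T → BAtLeast 5 U T →
  (S : SunSuper U T) → ChiMaximal S →
  (L : Labelling (Up S) (w S) (v S)) →
  NontrivialRotation L →
  (δ : ℕ) {{_ : NonZero δ}} → IsDelta L δ →
  (φ : Perm (suc (suc n))) → IsPhi L δ φ →
  let m = c L / δ
      caseI = ∀ l → IsAut (Up S) l → IsReflection L l →
                Σ ℕ λ k → (k < m) × (to l (X L (ν L)) ≡ to (pow φ k) (X L (ν L)))
      caseII = (deg (Up S) (X L (+ 0)) ≡ 3) ×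
               (∀ l → IsAut (Up S) l → IsReflection L l →
                 Σ ℕ λ k → (k < m) ×
                   (to l (X L (+ 0)) ≡ to (pow φ k) (X L (+ 0))))
  in ((caseI ⊎ caseII) →
        Σ (List (Perm (suc (suc n)))) λ Xs →
          Optimum (Up S) (w S) (v S) Xs
        × InterAutEq (Up S) Xs (InΦ φ m)
        × IsCyclicGroup (InΦ φ m) m)
   × (¬ caseI → ¬ caseII →
        Σ (Perm (suc (suc n))) λ π → IsAut (Up S) π × IsReflection L π ×
        Σ (List (Perm (suc (suc n)))) λ Xs →
          Optimum (Up S) (w S) (v S) Xs
        × InterAutEq (Up S) Xs (λ l → InΦ φ m l ⊎ InΦπ φ m π l)
        × IsDihedralGroup (λ l → InΦ φ m l ⊎ InΦπ φ m π l) m)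
theorem5p8 n U T _ _ _ S _ L nontrivial δ isδ φ isφ =
    WithPhi.cyclic L δ isδ φ isφ nontrivial
  , λ ¬caseI ¬caseII →
      let (α , mirror , off) = WithPhi.off-orbit-mirror L δ isδ φ isφ ¬caseI
      in WithPhi.Reflect.dihedral L δ isδ φ isφ α mirror off ¬caseII nontrivial
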